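{- Let $n\geq 1$ and $k\geq 0$ be integers, and let $\Gamma_{n,k}:\{1,\ldots,n\}^{k}\times \binom{\{1,\ldots,n\}}{k+1}\to \Sigma_{n}(k)$ be the map defined in the context. Then $\Gamma_{n,k}$ is surjective and its fibres are exactly the orbits of the shift modulo $n$ acting on $\{1,\ldots,n\}^{k}\times \binom{\{1,\ldots,n\}}{k+1}$. In particular, the preimage of each element of $\Sigma_{n}(k)$ has exactly $n$ elements, and \[|\Sigma_{n}(k)|=n^{k-1}\binom{n}{k+1}.\]
   Context: Permutations are multiplied as functions with the right factor applied first: $(\sigma\tau)(x)=\sigma(\tau(x))$. $\mathfrak S_n$ is the symmetric group on $\{1,\ldots,n\}$ and $\mathsf T_n$ its set of transpositions; a transposition is always written $(i\,j)$ with $i<j$. For $\sigma\in\mathfrak S_n$ let $|\sigma|=n-\ell(\sigma)$, where $\ell(\sigma)$ is the number of cycles of $\sigma$ (fixed points included). Write $\sigma_1\preccurlyeq\sigma_2$ iff $|\sigma_2|=|\sigma_1|+|\sigma_1^{ -1}\sigma_2|$. Define $\Sigma_n(k)=\{(\tau_1,\ldots,\tau_k)\in(\mathsf T_n)^k : |\tau_1\cdots\tau_k|=k,\ \tau_1\cdots\tau_k\preccurlyeq(1\,2\,\cdots\,n)\}$. Let $c=(1\,2\,\cdots\,n)$, i.e. $c(x)=x+1$ for $x<n$ and $c(n)=1$. The shift modulo $n$ is the action of $\mathbb Z/n\mathbb Z$ generated by applying $c$ to every coordinate of a sequence in $\{1,\ldots,n\}^k$ and to every element of a subset of $\{1,\ldots,n\}$.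 Parking process: for $E=(e_1,\ldots,e_k)\in\{1,\ldots,n\}^k$ and $O\subset\{1,\ldots,n\}$ with $|O|=k+1$, define $p_k,p_{k-1},\ldots,p_1$ backwards: $p_l=c^{r}(e_l)$ where $r$ is the least $s\in\{1,\ldots,n\}$ with $c^{s}(e_l)\in O\setminus\{p_{l+1},\ldots,p_k\}$. Put $\Pi(E,O)=(p_1,\ldots,p_k)$, and let the residue $\rho(E,O)$ be the unique element of $O\setminus\{p_1,\ldots,p_k\}$. Action of $\mathfrak S_k$ on $\Sigma_n(k)$: for $\gamma=((i_1\,j_1),\ldots,(i_k\,j_k))\in\Sigma_n(k)$ and $l\in\{1,\ldots,k-1\}$, let $\sigma_l=(l\;l+1)\in\mathfrak S_k$ act by: $\sigma_l\cdot\gamma=\gamma$ if $i_l=i_{l+1}$; if $i_l<i_{l+1}$, replace the pair $(g_l,g_{l+1})$ of consecutive entries by $(g_{l+1},\,g_{l+1}g_lg_{l+1})$; if $i_l>i_{l+1}$, replace it by $(g_lg_{l+1}g_l,\,g_l)$; other entries unchanged. These operations extend to a well-defined action of $\mathfrak S_k$ on $\Sigma_n(k)$ (for $\pi=\sigma_{l_1}\cdots\sigma_{l_r}$, $\pi\cdot\gamma=\sigma_{l_1}\cdot(\cdots(\sigma_{l_r}\cdot\gamma))$). $\mathfrak S_k$ acts on sequences by $\pi\cdot(x_1,\ldots,x_k)=(x_{\pi^{ -1}(1)},\ldots,x_{\pi^{ -1}(k)})$. Definition of $\Gamma_{n,k}(A,B)$ for $A\in\{1,\ldots,n\}^k$,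 $B\in\binom{\{1,\ldots,n\}}{k+1}$: set $\tilde A=c^{1-\rho(A,B)}A$, $\tilde B=c^{1-\rho(A,B)}B$ (so that $\rho(\tilde A,\tilde B)=1$); let $I=(i_1\leq\cdots\leq i_k)$ be the non-decreasing rearrangement of $\tilde A$ and $(j_1,\ldots,j_k)=\Pi(I,\tilde B)$. Then $((i_1\,j_1),\ldots,(i_k\,j_k))\in\Sigma_n(k)$ with $i_l<j_l$ for all $l$. Choose $\sigma\in\mathfrak S_k$ with $\sigma\cdot\tilde A=I$ and set $\Gamma_{n,k}(A,B)=\sigma^{ -1}\cdot((i_1\,j_1),\ldots,(i_k\,j_k))$; this does not depend on the choice of $\sigma$. -}

module Defs where

open import Data.Bool using (Bool; true; false; if_then_else_; _∧_)
open import Data.Nat as ℕ using (ℕ; zero; suc; _+_; _∸_; _≤ᵇ_; _<ᵇ_)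
open import Data.Nat.DivMod using (_mod_)
open import Data.Fin as F using (Fin; toℕ)
open import Data.Fin.Subset using (Subset; inside; outside; _-_; ∣_∣)
open import Data.Fin.Subset.Properties using (_∈?_)
open import Data.Fin.Permutation using (Permutation′; _⟨$⟩ʳ_; _∘ₚ_; flip; transpose; id)
open import Data.List.Base as L using (List; []; _∷_; upTo; allFin; filterᵇ; length; foldl; _++_)
open import Data.Bool.ListAction using (any; all)
open import Data.Maybe using (Maybe; just; nothing; fromMaybe)
open import Data.Product using (Σ; _×_; _,_; proj₁; proj₂)
open import Data.Vec as V using (Vec; []; _∷_; tabulate; zipWith)
open import Data.Vec.Relation.Unary.All using (All)
open import Relation.Nullary using (does)
open import Relation.Binary.PropositionalEquality using (_≡_)

-- Conventions.  The ground set {1,…,n} is Fin n, where the element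
-- x : Fin n stands for the integer toℕ x + 1.

c : ∀ {n} → Fin n → Fin n
c {suc m} x = suc (toℕ x) mod suc m

c^ : ∀ {n} → ℕ → Fin n → Fin n
c^ zero    x = x
c^ (suc s) x = c (c^ s x)

iter : ∀ {A : Set} → ℕ → (A → A) → A → A
iter zero    f x = x
iter (suc i) f x = f (iter i f x)

Perm : ℕ → Set
Perm n = Permutation′ n

-- product of permutations with the right factor applied first:
-- (σ ⊙ τ)(x) = σ(τ(x))   (stdlib's π₁ ∘ₚ π₂ applies π₁ first)
_⊙_ : ∀ {n} → Perm n → Perm n → Perm n
σ ⊙ τ = τ ∘ₚ σ

isCycleMin : ∀ {n} → (Fin n → Fin n) → Fin n → Bool
isCycleMin {n} f x = all (λ i → toℕ x ≤ᵇ toℕ (iter i f x)) (upTo n)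

numCycles : ∀ {n} → (Fin n → Fin n) → ℕ
numCycles {n} f = length (filterᵇ (isCycleMin f) (allFin n))

norm : ∀ {n} → (Fin n → Fin n) → ℕ
norm {n} f = n ∸ numCycles f

-- σ₁ ≼ σ₂  iff  |σ₂| = |σ₁| + |σ₁⁻¹ σ₂|
-- (σ₂ is given as a function, since it will be the cycle c)
_≼_ : ∀ {n} → Perm n → (Fin n → Fin n) → Set
σ₁ ≼ σ₂ = norm σ₂ ≡ norm (σ₁ ⟨$⟩ʳ_) + norm (λ x → flip σ₁ ⟨$⟩ʳ σ₂ x)

Tr : ℕ → Set
Tr n = Fin n × Fin n

trPerm : ∀ {n} → Tr n → Perm n
trPerm (i , j) = transpose i j

prodTr : ∀ {n k} → Vec (Tr n) k → Perm n
prodTr []       = id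
prodTr (t ∷ ts) = trPerm t ⊙ prodTr ts

IsTransposition : ∀ {n} → Tr n → Set
IsTransposition (i , j) = i F.< j

InΣ : ∀ n k → Vec (Tr n) k → Set
InΣ n k γ = All IsTransposition γ
          × norm (prodTr γ ⟨$⟩ʳ_) ≡ k
          × prodTr γ ≼ c

Σset : ℕ → ℕ → Set
Σset n k = Σ (Vec (Tr n) k) (InΣ n k)

firstHit : ∀ {n} → Subset n → Fin n → List ℕ → Maybe (Fin n)
firstHit A e []       = nothing
firstHit A e (s ∷ ss) = if does (c^ s e ∈? A) then just (c^ s e) else firstHit A e ss

-- c^r(e) with r the least s ∈ {1,…,n} such that c^s(e) ∈ A
-- (the default e is never used when A is nonempty)
park : ∀ {n} → Subset n → Fin n → Fin n
park {n} A e = fromMaybe e (firstHit A e (L.map suc (upTo n)))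

parkAll : ∀ {n k} → Subset n → Vec (Fin n) k → Vec (Fin n) k × Subset n
parkAll O []       = [] , O
parkAll O (e ∷ es) with parkAll O es
... | ps , R = (park R e ∷ ps) , (R - park R e)

Π : ∀ {n k} → Vec (Fin n) k → Subset n → Vec (Fin n) k
Π E O = proj₁ (parkAll O E)

firstIn : ∀ {n} → Subset n → Maybe (Fin n)
firstIn {n} R = L.head (filterᵇ (λ x → does (x ∈? R)) (allFin n))

-- residue ρ(E,O): the unique element of O ∖ {p_1,…,p_k}
ρ : ∀ {n k} → Vec (Fin n) k → Subset n → Maybe (Fin n)
ρ E O = firstIn (proj₂ (parkAll O E))

image : ∀ {n} → (Fin n → Fin n) → Subset n → Subset n
image {n} f B = tabulate (λ y → any (λ x → does (x ∈? B) ∧ does (f x F.≟ y)) (allFin n))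

Dom : ℕ → ℕ → Set
Dom n k = Vec (Fin n) k × Subset n

shift : ∀ {n k} → Dom n k → Dom n k
shift (A , B) = V.map c A , image c B

-- Actions of adjacent transpositions σ_{l+1} = (l+1 l+2) (l is 0-based)

actAdj : ∀ {A : Set} {k} → (A → A → A × A) → ℕ → Vec A k → Vec A k
actAdj f zero    (x ∷ y ∷ xs) = proj₁ (f x y) ∷ proj₂ (f x y) ∷ xs
actAdj f (suc l) (x ∷ xs)     = x ∷ actAdj f l xs
actAdj f _       xs           = xs

runWord : ∀ {A : Set} {k} → (A → A → A × A) → List ℕ → Vec A k → Vec A k
runWord f w v = foldl (λ u l → actAdj f l u) v w

swapPair : ∀ {A : Set} → A → A → A × A
swapPair x y = y , x

conj : ∀ {n} → Tr n → Tr n → Tr n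
conj (h₁ , h₂) (g₁ , g₂) = ordered (transpose h₁ h₂ ⟨$⟩ʳ g₁) (transpose h₁ h₂ ⟨$⟩ʳ g₂)
  where ordered : ∀ {n} → Fin n → Fin n → Tr n
        ordered a b = if toℕ a <ᵇ toℕ b then (a , b) else (b , a)

hurwitz : ∀ {n} → Tr n → Tr n → Tr n × Tr n
hurwitz g h =
  if does (proj₁ g F.≟ proj₁ h) then (g , h)
  else if toℕ (proj₁ g) <ᵇ toℕ (proj₁ h) then (h , conj h g)
  else (conj g h , g)

-- Sorting word: a word w (list of 0-based adjacent positions) with
-- runWord swapPair w v non-decreasing (insertion sort).

countLess : ∀ {n k} → Fin n → Vec (Fin n) k → ℕ
countLess x []       = 0
countLess x (y ∷ ys) = (if toℕ y <ᵇ toℕ x then 1 else 0) + countLess x ys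

sortWord : ∀ {n k} → Vec (Fin n) k → List ℕ
sortWord []       = []
sortWord (x ∷ xs) = L.map suc (sortWord xs) ++ upTo (countLess x xs)

-- exponent r with c^r = c^{1-ρ}: if ρ = x (standing for toℕ x + 1) then r = n − toℕ x
rotExp : ∀ {n k} → Vec (Fin n) k → Subset n → ℕ
rotExp {n} A B with ρ A B
... | just x  = n ∸ toℕ x
... | nothing = 0

Γ : ∀ {n k} → Vec (Fin n) k → Subset n → Vec (Tr n) k
Γ A B =
  let r  = rotExp A B
      Ã  = V.map (c^ r) A
      B̃  = image (c^ r) B
      w  = sortWord Ã                      -- σ = σ_{l_r}⋯σ_{l₁}, σ · Ã = I
      I  = runWord swapPair w Ã
      J  = Π I B̃
      γ₀ = zipWith _,_ I J
  in runWord hurwitz (L.reverse w) γ₀       -- σ⁻¹ · γ₀ = σ_{l₁}·(⋯(σ_{l_r}·γ₀))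

Fibre : ∀ n k → Vec (Tr n) k → Set
Fibre n k γ = Σ (Dom n k) (λ AB → ∣ proj₂ AB ∣ ≡ suc k × Γ (proj₁ AB) (proj₂ AB) ≡ γ)

module Submission where

-- After rotating so that the residue is 0 (the integer 1), A is read off from Γ(A,B) as the
-- sequence of smaller endpoints, because the Hurwitz operations permute these endpoints; they
-- are also involutions that preserve the product.  So everything reduces to sequences with
-- non-decreasing i.  For those, membership in Σ_n(k) is the nesting condition: l < l′ and
-- i_{l′} < j_l imply j_{l′} < j_l. Indeed multiplying by a transposition changes the number of
-- cycles by ±1, and |P| = k, P ≼ c mean that each τ_l splits a cycle of τ_{l-1} ⋯ τ_1 c; under
-- nesting τ_l ⋯ τ_1 c preserves [i_l , j_l), which separates i_l from j_l.  The same condition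
-- says that the cars i_k, …, i_1 park in j_k, …, j_1 when the spots are {0} ∪ {j_1, …, j_k},
-- and 0 is the residue.

open import Axiom.UniquenessOfIdentityProofs using (module Decidable⇒UIP)
open import Data.Bool using (Bool; true; false; T; _∧_; if_then_else_)
open import Data.Bool.Properties using (T-≡; T-∧; T?)
open import Data.Fin as F using (Fin; zero; suc; toℕ)
open import Data.Fin.Permutation using (_⟨$⟩ʳ_; _⟨$⟩ˡ_; inverseˡ; inverseʳ; flip; ↔⇒≡)
import Data.Fin.Properties as Fₚ
open import Data.Fin.Subset as Sub using (Subset; inside; outside; _∈_; _∉_; _∪_; _-_; ∣_∣; ⁅_⁆; Nonempty)
import Data.Fin.Subset.Properties as Subₚ
open import Data.List.Base as L using (List; []; _∷_; length; filterᵇ; allFin; upTo; applyUpTo)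
import Data.List.Membership.Propositional as L∈
open import Data.List.Membership.Propositional.Properties using (∈-allFin)
import Data.List.Properties as Lₚ
open import Data.List.Relation.Unary.All as LAll using ([]; _∷_)
import Data.List.Relation.Unary.All.Properties as LAllₚ
open import Data.List.Relation.Unary.AllPairs using ([]; _∷_)
open import Data.List.Relation.Unary.Any as LAny using (here; there)
import Data.List.Relation.Unary.Any.Properties as LAnyₚ
open import Data.List.Relation.Unary.Unique.Propositional using (Unique)
open import Data.List.Relation.Unary.Unique.Propositional.Properties using (allFin⁺)
open import Data.Maybe using (just; fromMaybe)
open import Data.Nat
  using (ℕ; zero; suc; _≤_; _<_; _*_; _^_; _+_; _∸_; _/_; _%_; _≤ᵇ_; _<ᵇ_; z≤n; s≤s; s≤s⁻¹)
open import Data.Nat.Combinatorics using (_C_; nCk+nC[k+1]≡[n+1]C[k+1]; nCn≡1; nCk≡nC[n∸k]; k>n⇒nCk≡0)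
import Data.Nat.DivMod as DM
open import Data.Nat.Induction using (<-wellFounded)
import Data.Nat.Properties as ℕₚ
open import Data.Product using (Σ; ∃; _×_; _,_; proj₁; proj₂)
open import Data.Product.Function.Dependent.Propositional using (Σ-↔)
open import Data.Product.Function.NonDependent.Propositional using (_×-↔_)
import Data.Product.Properties as ×ₚ
open import Data.Sum using (_⊎_; inj₁; inj₂)
open import Data.Sum.Function.Propositional using (_⊎-↔_)
open import Data.Unit using (⊤)
open import Data.Vec as V using (Vec; []; _∷_; here; there; zipWith)
import Data.Vec.Properties as Vₚ
open import Data.Vec.Relation.Unary.All as All using (All; []; _∷_)
import Data.Vec.Relation.Unary.All.Properties as Allₚ
open import Data.Vec.Relation.Unary.AllPairs using (AllPairs; []; _∷_)
open import Defs
open import Function.Base using (_∘_; case_of_)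
open import Function.Bundles using (_↔_; _⇔_; mk⇔; mk↔ₛ′; Inverse; Equivalence)
open import Function.Definitions using (Injective)
open import Function.Properties.Inverse using (↔-refl; ↔-sym; ↔-trans)
open import Induction.WellFounded using (Acc; acc)
open import Relation.Binary.Definitions using (Tri; tri<; tri≈; tri>)
open import Relation.Binary.PropositionalEquality
  using (_≡_; _≢_; _≗_; refl; sym; trans; cong; cong₂; subst; subst₂; module ≡-Reasoning)
open import Relation.Nullary using (¬_; Dec; yes; no; does; contradiction)
open import Relation.Nullary.Decidable using (dec-true; dec-false; map′)

-- Since |c| = n - 1, the conditions |P| = k and P ≼ c say that P⁻¹c has k + 1 cycles. As c has one
-- cycle and a transposition adds at most one, this is the extreme case, and equality is passed on
-- from step to step. Both directions of the nesting criterion work with invariant sets of points: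
-- an invariant set containing i_l but not j_l shows that τ_l has split a cycle, and conversely, if
-- τ_u splits a cycle, then i_u and j_u share an orbit and every invariant set containing i_u
-- contains j_u. A rotation moves the residue along with the pair. Hence each orbit of the shift has
-- exactly n elements, one for each residue, and a unique representative of residue 0. Injectivity,
-- surjectivity and both counts are settled for these representatives and then transported. Sorting
-- does no harm there because the set of spots left free does not depend on the order in which the
-- cars arrive.

private variable
  m n k : ℕ

-- Iterates and orbits of an injection of a finite set

iter-+ : ∀ {A : Set} (i j : ℕ) (f : A → A) x → iter (i + j) f x ≡ iter i f (iter j f x)
iter-+ zero    j f x = refl
iter-+ (suc i) j f x = cong f (iter-+ i j f x)

iter-inj : ∀ {A : Set} (i : ℕ) {f : A → A} → Injective _≡_ _≡_ f → Injective _≡_ _≡_ (iter i f)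
iter-inj zero    inj eq = eq
iter-inj (suc i) inj eq = iter-inj i inj (inj eq)

iter-fixed : ∀ {A : Set} (i : ℕ) {f : A → A} {x} → f x ≡ x → iter i f x ≡ x
iter-fixed zero    eq = refl
iter-fixed (suc i) {f} eq = trans (cong f (iter-fixed i eq)) eq

iter-cong : ∀ {A : Set} (i : ℕ) {f g : A → A} → f ≗ g → iter i f ≗ iter i g
iter-cong zero    eq x = refl
iter-cong (suc i) {f} eq x = trans (cong f (iter-cong i eq x)) (eq _)

iter-* : ∀ {A : Set} (i j : ℕ) (f : A → A) x → iter (i * j) f x ≡ iter i (iter j f) x
iter-* zero    j f x = refl
iter-* (suc i) j f x = trans (iter-+ j (i * j) f x) (cong (iter j f) (iter-* i j f x))

Orbit : (Fin n → Fin n) → Fin n → Fin n → Set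
Orbit f x y = ∃ λ i → iter i f x ≡ y

orbit-refl : ∀ {f : Fin n → Fin n} {x} → Orbit f x x
orbit-refl = 0 , refl

orbit-trans : ∀ {f : Fin n → Fin n} {x y z} → Orbit f x y → Orbit f y z → Orbit f x z
orbit-trans {f = f} {x} (i , refl) (j , refl) = j + i , iter-+ j i f x

orbit-invariant : ∀ {f : Fin n → Fin n} (S : Fin n → Set) → (∀ x → S x → S (f x)) →
                  ∀ {x y} → Orbit f x y → S x → S y
orbit-invariant S step (zero  , refl) s = s
orbit-invariant S step (suc i , refl) s = step _ (orbit-invariant S step (i , refl) s)

-- By pigeonhole two of the iterates with exponents 0, ..., n agree, and injectivity cancels the
-- smaller exponent.
period : (f : Fin n → Fin n) → Injective _≡_ _≡_ f →
         ∀ x → ∃ λ p → suc p ≤ n × iter (suc p) f x ≡ x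
period {n} f inj x with Fₚ.pigeonhole (ℕₚ.n<1+n n) (λ i → iter (toℕ i) f x)
... | i , j , i<j , eq = toℕ j ∸ suc (toℕ i) , bound , sym (iter-inj (toℕ i) inj eq′)
  where
  d = toℕ j ∸ suc (toℕ i)
  split : toℕ i + suc d ≡ toℕ j
  split = trans (ℕₚ.+-suc (toℕ i) d) (ℕₚ.m+[n∸m]≡n i<j)
  bound : suc d ≤ n
  bound = ℕₚ.≤-trans (ℕₚ.m≤n+m (suc d) (toℕ i))
            (subst (_≤ n) (sym split) (s≤s⁻¹ (Fₚ.toℕ<n j)))
  eq′ : iter (toℕ i) f x ≡ iter (toℕ i) f (iter (suc d) f x)
  eq′ = trans eq (trans (cong (λ t → iter t f x) (sym split)) (iter-+ (toℕ i) (suc d) f x))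

-- With period p + 1, another i * p steps after the first i complete i * (p + 1) steps, a whole
-- number of periods.
orbit-sym : ∀ {f : Fin n → Fin n} → Injective _≡_ _≡_ f →
            ∀ {x y} → Orbit f x y → Orbit f y x
orbit-sym {f = f} inj {x} (i , refl) with period f inj x
... | p , _ , px = i * p , (begin
  iter (i * p) f (iter i f x)  ≡⟨ iter-+ (i * p) i f x ⟨
  iter (i * p + i) f x         ≡⟨ cong (λ t → iter t f x) (trans (ℕₚ.+-comm (i * p) i) (sym (ℕₚ.*-suc i p))) ⟩
  iter (i * suc p) f x         ≡⟨ iter-* i (suc p) f x ⟩
  iter i (iter (suc p) f) x    ≡⟨ iter-fixed i px ⟩
  x                            ∎)
  where open ≡-Reasoning

-- Periods are subtracted until the exponent drops below n. This makes the finite test in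
-- `isCycleMin` agree with minimality over the whole orbit.
orbit-bounded : ∀ {f : Fin n → Fin n} → Injective _≡_ _≡_ f →
                ∀ {x y} → Orbit f x y → ∃ λ i → i < n × iter i f x ≡ y
orbit-bounded {n} {f} inj {x} (i , eq) = go i (<-wellFounded i) eq
  where
  go : ∀ i → Acc _<_ i → ∀ {y} → iter i f x ≡ y → ∃ λ j → j < n × iter j f x ≡ y
  go i (acc rec) eq with i ℕₚ.<? n
  ... | yes i<n = i , i<n , eq
  ... | no  i≮n with period f inj x
  ... | p , p<n , px = go (i ∸ suc p) (rec (ℕₚ.∸-monoʳ-< (s≤s z≤n) p≤i)) (begin
      iter (i ∸ suc p) f x                     ≡⟨ cong (iter (i ∸ suc p) f) px ⟨
      iter (i ∸ suc p) f (iter (suc p) f x)    ≡⟨ iter-+ (i ∸ suc p) (suc p) f x ⟨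
      iter (i ∸ suc p + suc p) f x             ≡⟨ cong (λ t → iter t f x) (ℕₚ.m∸n+n≡m p≤i) ⟩
      iter i f x                               ≡⟨ eq ⟩
      _                                        ∎)
    where
    open ≡-Reasoning
    p≤i : suc p ≤ i
    p≤i = ℕₚ.≤-trans p<n (ℕₚ.≮⇒≥ i≮n)

orbit? : ∀ {f : Fin n → Fin n} → Injective _≡_ _≡_ f → ∀ x y → Dec (Orbit f x y)
orbit? {f = f} inj x y = map′
  (λ { (i , eq) → toℕ i , eq })
  (λ o → let i , i<n , eq = orbit-bounded inj o in
         F.fromℕ< i<n , trans (cong (λ t → iter t f x) (Fₚ.toℕ-fromℕ< i<n)) eq)
  (Fₚ.any? λ i → iter (toℕ i) f x F.≟ y)

-- Least elements of orbits

IsMin : (Fin n → Fin n) → Fin n → Set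
IsMin f x = ∀ {y} → Orbit f x y → x F.≤ y

isCycleMin⁺ : ∀ (f : Fin n → Fin n) {x} → IsMin f x → isCycleMin f x ≡ true
isCycleMin⁺ {n} f {x} min = Equivalence.to T-≡ (LAllₚ.all⁻ (λ i → toℕ x ≤ᵇ toℕ (iter i f x))
  (LAllₚ.applyUpTo⁺₂ (λ i → i) n λ i → ℕₚ.≤⇒≤ᵇ (min (i , refl))))

isCycleMin⁻ : ∀ {f : Fin n → Fin n} → Injective _≡_ _≡_ f →
              ∀ {x} → isCycleMin f x ≡ true → IsMin f x
isCycleMin⁻ {n} {f} inj {x} eq o with orbit-bounded inj o
... | i , i<n , refl = ℕₚ.≤ᵇ⇒≤ _ _
  (LAllₚ.applyUpTo⁻ _ n (LAllₚ.all⁺ _ (upTo n) (Equivalence.from T-≡ eq)) i<n)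

isMin? : ∀ {f : Fin n → Fin n} → Injective _≡_ _≡_ f → ∀ x → IsMin f x ⊎ ∃ λ y → Orbit f x y × y F.< x
isMin? {n} {f} inj x with Fₚ.any? {n} (λ i → iter (toℕ i) f x F.<? x)
... | yes (i , lt) = inj₂ (_ , (toℕ i , refl) , lt)
... | no  none     = inj₁ min
  where
  min : IsMin f x
  min {y} o with orbit-bounded inj o
  ... | i , i<n , refl = ℕₚ.≮⇒≥ λ lt → none (F.fromℕ< i<n ,
        subst (λ t → iter t f x F.< x) (sym (Fₚ.toℕ-fromℕ< i<n)) lt)

orbitMin : ∀ {f : Fin n → Fin n} → Injective _≡_ _≡_ f → ∀ x → ∃ λ y → Orbit f x y × IsMin f y
orbitMin {f = f} inj x = go x (<-wellFounded (toℕ x))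
  where
  go : ∀ x → Acc _<_ (toℕ x) → ∃ λ y → Orbit f x y × IsMin f y
  go x (acc rec) with isMin? inj x
  ... | inj₁ min = x , orbit-refl , min
  ... | inj₂ (y , o , y<x) = let z , o′ , min = go y (rec y<x) in z , orbit-trans o o′ , min

-- Counting cycle minima

bool-ext : ∀ {p q : Bool} → (p ≡ true → q ≡ true) → (q ≡ true → p ≡ true) → p ≡ q
bool-ext {true}          f g = sym (f refl)
bool-ext {false} {true}  f g = g refl
bool-ext {false} {false} f g = refl

length-filterᵇ-≡ : ∀ {A : Set} {p q : A → Bool} {xs} → LAll.All (λ x → p x ≡ q x) xs →
                   length (filterᵇ p xs) ≡ length (filterᵇ q xs)
length-filterᵇ-≡ [] = refl
length-filterᵇ-≡ {p = p} {q} {x ∷ xs} (e ∷ es) with p x | q x | e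
... | true  | true  | refl = cong suc (length-filterᵇ-≡ es)
... | false | false | refl = length-filterᵇ-≡ es

length-filterᵇ-≤ : ∀ {A : Set} {p q : A → Bool} → (∀ x → p x ≡ true → q x ≡ true) → ∀ xs →
                   length (filterᵇ p xs) ≤ length (filterᵇ q xs)
length-filterᵇ-≤ p⇒q [] = z≤n
length-filterᵇ-≤ {p = p} {q} p⇒q (x ∷ xs) with p x | q x | p⇒q x
... | true  | true  | _ = s≤s (length-filterᵇ-≤ p⇒q xs)
... | true  | false | e = case e refl of λ ()
... | false | true  | _ = ℕₚ.m≤n⇒m≤1+n (length-filterᵇ-≤ p⇒q xs)
... | false | false | _ = length-filterᵇ-≤ p⇒q xs

length-filterᵇ-remove : ∀ {A : Set} {p q : A → Bool} {z} → p z ≡ true → q z ≡ false →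
  (∀ {x} → x ≢ z → p x ≡ q x) → ∀ {xs} → Unique xs → z L∈.∈ xs →
  length (filterᵇ p xs) ≡ suc (length (filterᵇ q xs))
length-filterᵇ-remove {p = p} {q} pz qz off {x ∷ xs} (x∉ ∷ _) (here refl)
  rewrite pz | qz = cong suc (length-filterᵇ-≡ (LAll.map (λ x≢y → off (x≢y ∘ sym)) x∉))
length-filterᵇ-remove {p = p} {q} pz qz off {x ∷ xs} (x∉ ∷ u) (there z∈)
  with p x | q x | off (LAll.lookup x∉ z∈)
... | true  | true  | refl = cong suc (length-filterᵇ-remove pz qz off u z∈)
... | false | false | refl = length-filterᵇ-remove pz qz off u z∈

numCycles-cong : {f g : Fin n → Fin n} → f ≗ g → numCycles f ≡ numCycles g
numCycles-cong {n} {f} {g} eq = length-filterᵇ-≡ {xs = allFin n} (LAll.universal same _)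
  where
  same : ∀ x → isCycleMin f x ≡ isCycleMin g x
  same x = cong (λ bs → L.foldr _∧_ true bs)
    (Lₚ.map-cong (λ i → cong (λ y → toℕ x ≤ᵇ toℕ y) (iter-cong i eq x)) (upTo n))

norm-cong : {f g : Fin n → Fin n} → f ≗ g → norm f ≡ norm g
norm-cong {n} eq = cong (n ∸_) (numCycles-cong eq)

numCycles≤n : (f : Fin n → Fin n) → numCycles f ≤ n
numCycles≤n f = ℕₚ.≤-trans (Lₚ.length-filter (λ x → T? (isCycleMin f x)) (allFin _))
  (ℕₚ.≤-reflexive (Lₚ.length-tabulate (λ i → i)))

numCycles-id : numCycles {n} (λ x → x) ≡ n
numCycles-id {n} = trans
  (cong length (Lₚ.filter-all (λ x → T? (isCycleMin (λ z → z) x)) (LAll.universal fixed-min (allFin n))))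
  (Lₚ.length-tabulate {n = n} (λ i → i))
  where
  fixed-min : ∀ x → T (isCycleMin (λ z → z) x)
  fixed-min x = Equivalence.from T-≡ (isCycleMin⁺ (λ z → z) {x} λ { (i , refl) →
    ℕₚ.≤-reflexive (cong toℕ (sym (iter-fixed i refl))) })

-- Composition with a transposition

-- The graph of the transposition (a b). As a relation it can be inverted, or have a and b
-- exchanged, by case analysis, without the decisions inside `transpose`.
data Swap {n} (a b : Fin n) : Fin n → Fin n → Set where
  fixed : ∀ {u} → u ≢ a → u ≢ b → Swap a b u u
  a↦b   : Swap a b a b
  b↦a   : Swap a b b a

swap-flip : ∀ {a b u v : Fin n} → Swap a b u v → Swap b a u v
swap-flip (fixed ≢a ≢b) = fixed ≢b ≢a
swap-flip a↦b = b↦a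
swap-flip b↦a = a↦b

swap-sym : ∀ {a b u v : Fin n} → Swap a b u v → Swap a b v u
swap-sym (fixed ≢a ≢b) = fixed ≢a ≢b
swap-sym a↦b = b↦a
swap-sym b↦a = a↦b

SwapAfter : Fin n → Fin n → (f g : Fin n → Fin n) → Set
SwapAfter a b f g = ∀ x → Swap a b (f x) (g x)

module _ {f g : Fin n → Fin n} {a b : Fin n}
         (f-inj : Injective _≡_ _≡_ f) (g-inj : Injective _≡_ _≡_ g)
         (sw : SwapAfter a b f g) where

  -- An f-step differs from a g-step at most by a jump between a and b, which lie in one g-orbit by
  -- assumption.
  orbit-absorb : Orbit g a b → ∀ {x y} → Orbit f x y → Orbit g x y
  orbit-absorb ab (zero  , refl) = orbit-refl
  orbit-absorb ab {x} (suc i , refl) = orbit-trans (orbit-absorb ab (i , refl)) (step (sw _))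
    where
    u = iter i f x
    step′ : ∀ {v w} → Swap a b v w → w ≡ g u → Orbit g u v
    step′ (fixed _ _) eq = 1 , sym eq
    step′ a↦b         eq = orbit-trans (1 , sym eq) (orbit-sym g-inj ab)
    step′ b↦a         eq = orbit-trans (1 , sym eq) ab
    step : Swap a b (f u) (g u) → Orbit g u (f u)
    step s = step′ s refl

  -- Along the f-orbit of a the two maps agree until f returns to a, for b is never met; at that
  -- return g goes to b instead.
  orbit-join : ¬ Orbit f a b → Orbit g a b
  orbit-join a≁b with period f f-inj a
  ... | p , _ , pa = last (walk p)
    where
    walk : ∀ i → Orbit g a (iter i f a) ⊎ Orbit g a b
    walk zero    = inj₁ orbit-refl
    walk (suc i) with walk i
    ... | inj₂ ab = inj₂ ab
    ... | inj₁ o  = step (sw _) refl refl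
      where
      step : ∀ {v w} → Swap a b v w → v ≡ f (iter i f a) → w ≡ g (iter i f a) →
             Orbit g a v ⊎ Orbit g a b
      step (fixed _ _) ev ew = inj₁ (orbit-trans o (1 , sym ew))
      step a↦b         ev ew = inj₂ (orbit-trans o (1 , sym ew))
      step b↦a         ev ew = contradiction (suc i , sym ev) a≁b
    last : Orbit g a (iter p f a) ⊎ Orbit g a b → Orbit g a b
    last (inj₂ ab) = ab
    last (inj₁ o)  = step (sw (iter p f a)) pa refl
      where
      step : ∀ {v w} → Swap a b v w → v ≡ a → w ≡ g (iter p f a) → Orbit g a b
      step (fixed ≢a _) ev ew = contradiction ev ≢a
      step a↦b          ev ew = orbit-trans o (1 , sym ew)
      step b↦a          ev ew = contradiction (0 , sym ev) a≁b

  -- Joining two orbits destroys exactly one minimum, the larger of the two (here that of b).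
  join-ordered : ∀ {α β} → Orbit f a α → IsMin f α → Orbit f b β → IsMin f β → α F.< β →
                 ¬ Orbit f a b → numCycles f ≡ suc (numCycles g)
  join-ordered {α} {β} aα minα bβ minβ α<β a≁b =
    length-filterᵇ-remove {z = β} (isCycleMin⁺ f minβ) β-lost
      (λ x≢β → bool-ext (to x≢β) (from x≢β)) (allFin⁺ n) (∈-allFin β)
    where
    ab : Orbit g a b
    ab = orbit-join a≁b

    sub : ∀ {x y} → Orbit f x y → Orbit g x y
    sub = orbit-absorb ab

    rep : Fin n → Fin n
    rep x = proj₁ (orbitMin f-inj x)

    rep-unique : ∀ {x y} → Orbit f x y → IsMin f y → rep x ≡ y
    rep-unique {x} {y} o min = let z , o′ , min′ = orbitMin f-inj x in
      Fₚ.≤-antisym (min′ (orbit-trans (orbit-sym f-inj o′) o)) (min (orbit-trans (orbit-sym f-inj o) o′))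

    rep-step : ∀ x → rep (f x) ≡ rep x
    rep-step x = let z , o , min = orbitMin f-inj x in
      rep-unique (orbit-trans (orbit-sym f-inj (1 , refl)) o) min

    rep-≤ : ∀ x → rep x F.≤ x
    rep-≤ x = let z , o , min = orbitMin f-inj x in min (orbit-sym f-inj o)

    glue : Fin n → Fin n
    glue r with r F.≟ β
    ... | yes _ = α
    ... | no  _ = r

    glue-β : glue β ≡ α
    glue-β with β F.≟ β
    ... | yes _  = refl
    ... | no  ¬p = contradiction refl ¬p

    glue-off : ∀ {r} → r ≢ β → glue r ≡ r
    glue-off {r} r≢β with r F.≟ β
    ... | yes p = contradiction p r≢β
    ... | no  _ = refl

    glue-≤ : ∀ r → glue r F.≤ r
    glue-≤ r with r F.≟ β
    ... | yes refl = ℕₚ.<⇒≤ α<β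
    ... | no  _    = ℕₚ.≤-refl

    -- `label x` is the minimum of the f-orbit of x, with β replaced by α. It is constant on
    -- g-orbits and never exceeds x, so every f-minimum other than β stays minimal for g.
    label : Fin n → Fin n
    label x = glue (rep x)

    label-a : label a ≡ α
    label-a = trans (cong glue (rep-unique aα minα)) (glue-off (Fₚ.<⇒≢ α<β))

    label-b : label b ≡ α
    label-b = trans (cong glue (rep-unique bβ minβ)) glue-β

    label-swap : ∀ {u v} → Swap a b u v → label v ≡ label u
    label-swap (fixed _ _) = refl
    label-swap a↦b = trans label-b (sym label-a)
    label-swap b↦a = trans label-a (sym label-b)

    label-orbit : ∀ {x y} → Orbit g x y → label y ≡ label x
    label-orbit {x} o = orbit-invariant (λ y → label y ≡ label x)
      (λ y e → trans (trans (label-swap (sw y)) (cong glue (rep-step y))) e) o refl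

    label-≤ : ∀ x → label x F.≤ x
    label-≤ x = ℕₚ.≤-trans (glue-≤ (rep x)) (rep-≤ x)

    βα : Orbit g β α
    βα = orbit-trans (sub (orbit-sym f-inj bβ)) (orbit-trans (orbit-sym g-inj ab) (sub aα))

    β-lost : isCycleMin g β ≡ false
    β-lost with isCycleMin g β in eq
    ... | false = refl
    ... | true  = contradiction (isCycleMin⁻ g-inj eq βα) (ℕₚ.<⇒≱ α<β)

    to : ∀ {x} → x ≢ β → isCycleMin f x ≡ true → isCycleMin g x ≡ true
    to {x} x≢β eq = isCycleMin⁺ g λ {y} o → ℕₚ.≤-trans
      (ℕₚ.≤-reflexive (cong toℕ (sym (trans (label-orbit o)
        (trans (cong glue (rep-unique orbit-refl (isCycleMin⁻ f-inj {x} eq))) (glue-off x≢β))))))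
      (label-≤ y)

    from : ∀ {x} → x ≢ β → isCycleMin g x ≡ true → isCycleMin f x ≡ true
    from {x} _ eq = isCycleMin⁺ f λ o → isCycleMin⁻ g-inj {x} eq (sub o)

  -- When g joins a and b, its orbits are unions of f-orbits, so every g-minimum is an f-minimum.
  numCycles-≤ : Orbit g a b → numCycles g ≤ numCycles f
  numCycles-≤ ab = length-filterᵇ-≤
    (λ x eq → isCycleMin⁺ f λ o → isCycleMin⁻ g-inj {x} eq (orbit-absorb ab o)) (allFin n)

numCycles-join : ∀ {f g : Fin n → Fin n} {a b} → Injective _≡_ _≡_ f → Injective _≡_ _≡_ g →
                 SwapAfter a b f g → ¬ Orbit f a b → numCycles f ≡ suc (numCycles g)
numCycles-join {f = f} {g} {a} {b} f-inj g-inj sw a≁b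
  with orbitMin f-inj a | orbitMin f-inj b
... | α , aα , minα | β , bβ , minβ with Fₚ.<-cmp α β
... | tri< α<β _ _ = join-ordered f-inj g-inj sw aα minα bβ minβ α<β a≁b
... | tri≈ _ refl _ = contradiction (orbit-trans aα (orbit-sym f-inj bβ)) a≁b
... | tri> _ _ β<α = join-ordered f-inj g-inj (λ x → swap-flip (sw x))
        bβ minβ aα minα β<α (λ o → a≁b (orbit-sym f-inj o))

module _ {f g : Fin n → Fin n} {a b : Fin n}
         (f-inj : Injective _≡_ _≡_ f) (g-inj : Injective _≡_ _≡_ g)
         (sw : SwapAfter a b f g) where

  numCycles-split : ¬ Orbit g a b → numCycles g ≡ suc (numCycles f)
  numCycles-split = numCycles-join g-inj f-inj (λ x → swap-sym (sw x))

  numCycles-swap-≤ : numCycles g ≤ suc (numCycles f)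
  numCycles-swap-≤ with orbit? g-inj a b
  ... | yes ab  = ℕₚ.m≤n⇒m≤1+n (numCycles-≤ f-inj g-inj sw ab)
  ... | no  a≁b = ℕₚ.≤-reflexive (numCycles-split a≁b)

  numCycles-split⁻ : numCycles g ≡ suc (numCycles f) → Orbit f a b
  numCycles-split⁻ eq with orbit? f-inj a b
  ... | yes ab  = ab
  ... | no  a≁b = contradiction (trans eq (cong suc (numCycles-join f-inj g-inj sw a≁b)))
                    (ℕₚ.<⇒≢ (ℕₚ.m≤n⇒m≤1+n (ℕₚ.n<1+n _)))

both : ∀ {A : Set} {P Q R : A → Set} {xs : Vec A k} → (∀ {x} → P x → Q x → R x) →
       All P xs → All Q xs → All R xs
both f []       []       = []
both f (p ∷ ps) (q ∷ qs) = f p q ∷ both f ps qs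

-- Rotation

suc-% : ∀ a → suc (a % suc m) % suc m ≡ suc a % suc m
suc-% {m} a = begin
  suc (a % suc m) % suc m                              ≡⟨ DM.%-distribˡ-+ 1 (a % suc m) (suc m) ⟩
  (1 % suc m + a % suc m % suc m) % suc m              ≡⟨ cong (λ t → (1 % suc m + t) % suc m) (DM.m%n%n≡m%n a (suc m)) ⟩
  (1 % suc m + a % suc m) % suc m                      ≡⟨ DM.%-distribˡ-+ 1 a (suc m) ⟨
  suc a % suc m                                        ∎
  where open ≡-Reasoning

toℕ-c : (x : Fin (suc m)) → toℕ (c x) ≡ suc (toℕ x) % suc m
toℕ-c x = Fₚ.toℕ-fromℕ< _

toℕ-c^ : ∀ s (x : Fin (suc m)) → toℕ (c^ s x) ≡ (s + toℕ x) % suc m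
toℕ-c^ zero    x = sym (DM.m<n⇒m%n≡m (Fₚ.toℕ<n x))
toℕ-c^ {m} (suc s) x = trans (toℕ-c (c^ s x))
  (trans (cong (λ t → suc t % suc m) (toℕ-c^ s x)) (suc-% {m} (s + toℕ x)))

c^-≡-iter : ∀ s (x : Fin n) → c^ s x ≡ iter s c x
c^-≡-iter zero    x = refl
c^-≡-iter (suc s) x = cong c (c^-≡-iter s x)

c^-+ : ∀ s t (x : Fin n) → c^ (s + t) x ≡ c^ s (c^ t x)
c^-+ zero    t x = refl
c^-+ (suc s) t x = cong c (c^-+ s t x)

c^-n : (x : Fin n) → c^ n x ≡ x
c^-n {suc m} x = Fₚ.toℕ-injective (begin
  toℕ (c^ (suc m) x)          ≡⟨ toℕ-c^ (suc m) x ⟩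
  (suc m + toℕ x) % suc m     ≡⟨ trans (cong (_% suc m) (ℕₚ.+-comm (suc m) (toℕ x))) (DM.[m+n]%n≡m%n (toℕ x) (suc m)) ⟩
  toℕ x % suc m               ≡⟨ DM.m<n⇒m%n≡m (Fₚ.toℕ<n x) ⟩
  toℕ x                       ∎)
  where open ≡-Reasoning

c-injective : Injective {A = Fin n} _≡_ _≡_ c
c-injective {suc m} {x} {y} eq = trans (sym (back x)) (trans (cong (c^ m) eq) (back y))
  where
  back : ∀ z → c^ m (c z) ≡ z
  back z = trans (sym (c^-+ m 1 z)) (trans (cong (λ t → c^ t z) (ℕₚ.+-comm m 1)) (c^-n z))

c^-zero : (x : Fin (suc m)) → c^ (suc m ∸ toℕ x) x ≡ zero
c^-zero {m} x = Fₚ.toℕ-injective (begin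
  toℕ (c^ (suc m ∸ toℕ x) x)           ≡⟨ toℕ-c^ (suc m ∸ toℕ x) x ⟩
  (suc m ∸ toℕ x + toℕ x) % suc m      ≡⟨ cong (_% suc m) (ℕₚ.m∸n+n≡m (ℕₚ.<⇒≤ (Fₚ.toℕ<n x))) ⟩
  suc m % suc m                        ≡⟨ DM.n%n≡0 (suc m) ⟩
  0                                    ∎)
  where open ≡-Reasoning

c^-below : ∀ s (x : Fin n) → s + toℕ x < n → toℕ (c^ s x) ≡ s + toℕ x
c^-below {suc m} s x lt = trans (toℕ-c^ s x) (DM.m<n⇒m%n≡m lt)

-- Every orbit of c passes through `zero`, which is therefore the only minimum.
numCycles-c : numCycles (c {suc m}) ≡ 1
numCycles-c {m} = trans
  (length-filterᵇ-remove {q = λ _ → false} {z = zero}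
    (isCycleMin⁺ (c {suc m}) {zero} λ _ → z≤n) refl (λ {x} → nonzero x) (allFin⁺ (suc m)) (∈-allFin zero))
  (cong suc (none (allFin (suc m))))
  where
  none : ∀ {A : Set} (xs : L.List A) → length (filterᵇ (λ _ → false) xs) ≡ 0
  none L.[]       = refl
  none (x L.∷ xs) = none xs
  nonzero : ∀ x → x ≢ zero → isCycleMin c x ≡ false
  nonzero x x≢0 with isCycleMin c x in eq
  ... | false = refl
  ... | true  = contradiction
    (Fₚ.toℕ-injective (ℕₚ.n≤0⇒n≡0 (isCycleMin⁻ c-injective {x} eq
      (suc m ∸ toℕ x , trans (sym (c^-≡-iter (suc m ∸ toℕ x) x)) (c^-zero x))))) x≢0

-- Products of transpositions

act : Tr n → Fin n → Fin n
act t = trPerm t ⟨$⟩ʳ_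

act-swap : ∀ (t : Tr n) x → Swap (proj₁ t) (proj₂ t) x (act t x)
act-swap (i , j) x with x F.≟ i
... | yes refl = a↦b
... | no  x≢i with x F.≟ j
...   | yes refl = b↦a
...   | no  x≢j  = fixed x≢i x≢j

swap-unique : ∀ {a b u v w : Fin n} → Swap a b u v → Swap a b u w → v ≡ w
swap-unique (fixed _ _)  (fixed _ _)  = refl
swap-unique (fixed ≢a _) a↦b          = contradiction refl ≢a
swap-unique (fixed _ ≢b) b↦a          = contradiction refl ≢b
swap-unique a↦b          (fixed ≢a _) = contradiction refl ≢a
swap-unique a↦b          a↦b          = refl
swap-unique a↦b          b↦a          = refl
swap-unique b↦a          (fixed _ ≢b) = contradiction refl ≢b
swap-unique b↦a          a↦b          = refl
swap-unique b↦a          b↦a          = refl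

swap⇒act : ∀ (t : Tr n) {x y} → Swap (proj₁ t) (proj₂ t) x y → act t x ≡ y
swap⇒act t {x} s = swap-unique (act-swap t x) s

swap-preserves : ∀ (S : Fin n → Set) {a b u v} → (S a → S b) → (S b → S a) → Swap a b u v → S u → S v
swap-preserves S ab ba (fixed _ _) s = s
swap-preserves S ab ba a↦b         s = ab s
swap-preserves S ab ba b↦a         s = ba s

act-involutive : ∀ (t : Tr n) x → act t (act t x) ≡ x
act-involutive t x = swap⇒act t (swap-sym (act-swap t x))

act-injective : ∀ (t : Tr n) → Injective _≡_ _≡_ (act t)
act-injective t {x} {y} eq =
  trans (sym (act-involutive t x)) (trans (cong (act t) eq) (act-involutive t y))

act-flip : ∀ (t : Tr n) x → flip (trPerm t) ⟨$⟩ʳ x ≡ act t x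
-- The inverse of `transpose i j` computes to `transpose j i`, hence the exchanged pair.
act-flip t x = swap-unique (swap-flip (act-swap (proj₂ t , proj₁ t) x)) (act-swap t x)

perm-injective : (π : Perm n) → Injective _≡_ _≡_ (π ⟨$⟩ʳ_)
perm-injective π eq = trans (sym (inverseˡ π)) (trans (cong (π ⟨$⟩ˡ_) eq) (inverseˡ π))

-- cut (τ₁ ∷ … ∷ τ_k) f = τ_k ⋯ τ₁ f
cut : Vec (Tr n) k → (Fin n → Fin n) → Fin n → Fin n
cut []       f = f
cut (t ∷ ts) f = cut ts (act t ∘ f)

-- P⁻¹ applies τ_1 first, which is the order in which `cut` composes; so ≼ becomes a statement about
-- the cycle count of `cut`.
flip-prodTr : ∀ (ts : Vec (Tr n) k) f → (λ x → flip (prodTr ts) ⟨$⟩ʳ f x) ≗ cut ts f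
flip-prodTr []       f x = refl
flip-prodTr (t ∷ ts) f x =
  trans (cong (flip (prodTr ts) ⟨$⟩ʳ_) (act-flip t (f x))) (flip-prodTr ts (act t ∘ f) x)

-- For i_t ≤ i_u this says that i_t and j_t avoid the half-open interval (i_u , j_u].
Nest : Tr n → Tr n → Set
Nest t u = (proj₁ t F.≤ proj₁ u) × (proj₁ u F.< proj₂ t → proj₂ u F.< proj₂ t)

-- The trace of c(x) = x + 1 on a segment: f maps [i , j) into (i , j]. Unlike equality with c, this
-- survives composition with the earlier transpositions of a nested sequence.
Follows : (Fin n → Fin n) → Tr n → Set
Follows f (i , j) = ∀ x → i F.≤ x → x F.< j → i F.< f x × f x F.≤ j

Within : Tr n → Fin n → Set
Within (i , j) x = i F.≤ x × x F.< j

-- Sequences of transpositions that split a cycle at every step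

module _ {f : Fin n → Fin n} (f-inj : Injective _≡_ _≡_ f) where

  act-after : ∀ (t : Tr n) → SwapAfter (proj₁ t) (proj₂ t) f (act t ∘ f)
  act-after t x = act-swap t (f x)

  act∘-injective : ∀ (t : Tr n) → Injective _≡_ _≡_ (act t ∘ f)
  act∘-injective t eq = f-inj (act-injective t eq)

cut-≤ : ∀ {f : Fin n → Fin n} → Injective _≡_ _≡_ f → ∀ (ts : Vec (Tr n) k) →
        numCycles (cut ts f) ≤ k + numCycles f
cut-≤ f-inj []       = ℕₚ.≤-refl
cut-≤ {k = suc k} {f} f-inj (t ∷ ts) = begin
  numCycles (cut ts (act t ∘ f))   ≤⟨ cut-≤ (act∘-injective f-inj t) ts ⟩
  k + numCycles (act t ∘ f)        ≤⟨ ℕₚ.+-monoʳ-≤ k (numCycles-swap-≤ f-inj (act∘-injective f-inj t) (act-after f-inj t)) ⟩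
  k + suc (numCycles f)            ≡⟨ ℕₚ.+-suc k (numCycles f) ⟩
  suc (k + numCycles f)            ∎
  where open ℕₚ.≤-Reasoning

-- The total gain is k + 1 and each of the k + 1 transpositions gains at most one, so the first one
-- gains exactly one, and it does so only by splitting an orbit.
cut-tight : ∀ {f : Fin n → Fin n} → Injective _≡_ _≡_ f → ∀ t (ts : Vec (Tr n) k) →
            numCycles (cut (t ∷ ts) f) ≡ suc k + numCycles f →
            Orbit f (proj₁ t) (proj₂ t) ×
            numCycles (cut ts (act t ∘ f)) ≡ k + numCycles (act t ∘ f)
cut-tight {k = k} {f} f-inj t ts eq = numCycles-split⁻ f-inj g-inj sw one ,
  trans eq (trans (sym (ℕₚ.+-suc k _)) (cong (k +_) (sym one)))
  where
  sw = act-after f-inj t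
  g-inj = act∘-injective f-inj t
  one : numCycles (act t ∘ f) ≡ suc (numCycles f)
  one = ℕₚ.≤-antisym (numCycles-swap-≤ f-inj g-inj sw) (ℕₚ.+-cancelˡ-≤ k _ _ (begin
    k + suc (numCycles f)             ≡⟨ ℕₚ.+-suc k (numCycles f) ⟩
    suc (k + numCycles f)             ≡⟨ eq ⟨
    numCycles (cut ts (act t ∘ f))    ≤⟨ cut-≤ g-inj ts ⟩
    k + numCycles (act t ∘ f)         ∎))
    where open ℕₚ.≤-Reasoning

-- Tightness puts i_t and j_t in one orbit, so S contains j_t whenever it contains i_t. With the
-- assumed converse, t preserves S; thus S is invariant for the next map and the argument repeats.
cut-unseparated : ∀ {f : Fin n → Fin n} → Injective _≡_ _≡_ f → (S : Fin n → Set) →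
  (∀ x → S x → S (f x)) → ∀ (ts : Vec (Tr n) k) → All (λ t → S (proj₂ t) → S (proj₁ t)) ts →
  numCycles (cut ts f) ≡ k + numCycles f → All (λ t → S (proj₁ t) → S (proj₂ t)) ts
cut-unseparated f-inj S inv []       []         eq = []
cut-unseparated f-inj S inv (t ∷ ts) (ba ∷ bas) eq =
  let o , eq′ = cut-tight f-inj t ts eq
      ab      = orbit-invariant S inv o
  in ab ∷ cut-unseparated (act∘-injective f-inj t) S
       (λ x s → swap-preserves S ab ba (act-swap t _) (inv x s)) ts bas eq′

-- f sends [i , j) into (i , j], and the transposition then brings j back to i.
follows⇒within : ∀ {f : Fin n → Fin n} t → IsTransposition t → Follows f t →
                 ∀ x → Within t x → Within t (act t (f x))
follows⇒within {f = f} t@(i , j) i<j fol x (i≤x , x<j) =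
  let i<fx , fx≤j = fol x i≤x x<j in swapped i<fx fx≤j (act-swap t (f x))
  where
  swapped : ∀ {u v} → i F.< u → u F.≤ j → Swap i j u v → Within t v
  swapped i<u u≤j (fixed _ u≢j) = ℕₚ.<⇒≤ i<u , Fₚ.≤∧≢⇒< u≤j u≢j
  swapped i<u u≤j a↦b = contradiction i<u (ℕₚ.<-irrefl refl)
  swapped i<u u≤j b↦a = ℕₚ.≤-refl , i<j

-- On (i_u , j_u] the transposition t is the identity.
follows-nest : ∀ {f : Fin n → Fin n} t u → IsTransposition t → Nest t u → Follows f u → Follows (act t ∘ f) u
follows-nest {f = f} t u i<j (it≤iu , nest) fol x p q =
  let r@(l , h) = fol x p q in swap-preserves (λ y → proj₁ u F.< y × y F.≤ proj₂ u)
    (λ (iu<it , _) → contradiction it≤iu (ℕₚ.<⇒≱ iu<it))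
    (λ (iu<jt , jt≤ju) → contradiction jt≤ju (ℕₚ.<⇒≱ (nest iu<jt)))
    (act-swap t (f x)) r

nest⇒tight : ∀ {f : Fin n → Fin n} → Injective _≡_ _≡_ f → ∀ {ts : Vec (Tr n) k} →
             All IsTransposition ts → AllPairs Nest ts → All (Follows f) ts →
             numCycles (cut ts f) ≡ k + numCycles f
nest⇒tight f-inj [] [] [] = refl
nest⇒tight {k = suc k} {f} f-inj {t ∷ ts} (o ∷ os) (ns ∷ nss) (fol ∷ fols) = begin
  numCycles (cut ts (act t ∘ f))   ≡⟨ nest⇒tight g-inj os nss (both (λ {u} nst fl → follows-nest t u o nst fl) ns fols) ⟩
  k + numCycles (act t ∘ f)        ≡⟨ cong (k +_) (numCycles-split f-inj g-inj (act-after f-inj t) separated) ⟩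
  k + suc (numCycles f)            ≡⟨ ℕₚ.+-suc k (numCycles f) ⟩
  suc (k + numCycles f)            ∎
  where
  open ≡-Reasoning
  g-inj = act∘-injective f-inj t
  separated : ¬ Orbit (act t ∘ f) (proj₁ t) (proj₂ t)
  separated p = ℕₚ.<-irrefl refl
    (proj₂ (orbit-invariant (Within t) (follows⇒within t o fol) p (ℕₚ.≤-refl , o)))

tight⇒nest : ∀ {f : Fin n → Fin n} → Injective _≡_ _≡_ f → ∀ {ts : Vec (Tr n) k} →
             All IsTransposition ts → AllPairs (λ t u → proj₁ t F.≤ proj₁ u) ts → All (Follows f) ts →
             numCycles (cut ts f) ≡ k + numCycles f → AllPairs Nest ts
tight⇒nest f-inj [] [] [] eq = []
tight⇒nest {n = n} {f = f} f-inj {t ∷ ts} (o ∷ os) (s ∷ ss) (fol ∷ fols) eq =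
  nests ∷ tight⇒nest g-inj os ss
    (both (λ {u} nst fl → follows-nest t u o nst fl) nests fols) eq′
  where
  g-inj = act∘-injective f-inj t
  eq′ = proj₂ (cut-tight f-inj t ts eq)
  -- [i_t , j_t) is invariant once t has been applied. Since i_t ≤ i_u < j_u, it contains i_u
  -- whenever it contains j_u; tightness gives the converse, which is the nesting condition.
  nests : All (Nest t) ts
  nests = both (λ it≤iu ab → it≤iu , λ iu<jt → proj₂ (ab (it≤iu , iu<jt)))
    s (cut-unseparated g-inj (Within t) (follows⇒within t o fol) ts
      (both (λ it≤iu iu<ju (_ , ju<jt) → it≤iu , ℕₚ.<-trans iu<ju ju<jt) s os) eq′)

-- No later transposition of a nested sequence crosses j_t, so none joins i_t to j_t.
nest⇒numCycles : ∀ {ts : Vec (Tr n) k} → All IsTransposition ts → AllPairs Nest ts →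
                 k + numCycles (prodTr ts ⟨$⟩ʳ_) ≡ n
nest⇒numCycles [] [] = numCycles-id
nest⇒numCycles {n = n} {k = suc k} {t ∷ ts} (o ∷ os) (ns ∷ nss) =
  trans (sym (ℕₚ.+-suc k _)) (trans (cong (k +_) (sym joined)) (nest⇒numCycles os nss))
  where
  p-inj = perm-injective (prodTr ts)
  below : ∀ {k} {us : Vec (Tr n) k} → All IsTransposition us → All (Nest t) us →
          ∀ x → x F.< proj₂ t → prodTr us ⟨$⟩ʳ x F.< proj₂ t
  below []       []       x lt = lt
  below {us = u ∷ _} (o ∷ os) (nst ∷ ns) x lt = swap-preserves (F._< proj₂ t)
    (proj₂ nst) (ℕₚ.<-trans o) (act-swap u _) (below os ns x lt)
  joined : numCycles (prodTr ts ⟨$⟩ʳ_) ≡ suc (numCycles (act t ∘ (prodTr ts ⟨$⟩ʳ_)))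
  joined = numCycles-join p-inj (act∘-injective p-inj t) (act-after p-inj t)
    λ p → ℕₚ.<-irrefl refl (orbit-invariant (F._< proj₂ t) (below os ns) p o)

c-follows : ∀ (t : Tr n) → Follows c t
c-follows (i , j) x i≤x x<j = ℕₚ.≤-trans (s≤s i≤x) (ℕₚ.≤-reflexive (sym cx)) , ℕₚ.≤-trans (ℕₚ.≤-reflexive cx) x<j
  where
  cx : toℕ (c x) ≡ suc (toℕ x)
  cx = c^-below 1 x (ℕₚ.≤-<-trans x<j (Fₚ.toℕ<n j))

nest⇒InΣ : ∀ {ts : Vec (Tr (suc m)) k} → All IsTransposition ts → AllPairs Nest ts → InΣ (suc m) k ts
nest⇒InΣ {m} {k} {ts} os ns = os , norm≡k , (begin
  norm (c {suc m})                          ≡⟨ cong (suc m ∸_) (numCycles-c {m}) ⟩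
  m                                         ≡⟨ ℕₚ.m+[n∸m]≡n k≤m ⟨
  k + (m ∸ k)                               ≡⟨ cong₂ _+_ (sym norm≡k) (cong (suc m ∸_) (sym cuts)) ⟩
  norm (prodTr ts ⟨$⟩ʳ_) + norm (cut ts c)   ≡⟨ cong (norm (prodTr ts ⟨$⟩ʳ_) +_) (norm-cong {suc m} (flip-prodTr ts c)) ⟨
  _                                         ∎)
  where
  open ≡-Reasoning
  cuts : numCycles (cut ts c) ≡ suc k
  cuts = trans (nest⇒tight c-injective os ns (All.universal c-follows ts))
    (trans (cong (k +_) (numCycles-c {m})) (ℕₚ.+-comm k 1))
  -- Subtraction is truncated, so k ≤ m has to be known: k + 1 cycles require at least k + 1 points.
  k≤m : k ≤ m
  k≤m = s≤s⁻¹ (subst (_≤ suc m) cuts (numCycles≤n (cut ts c)))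
  norm≡k : norm (prodTr ts ⟨$⟩ʳ_) ≡ k
  norm≡k = trans (cong (_∸ numCycles (prodTr ts ⟨$⟩ʳ_)) (sym (nest⇒numCycles os ns))) (ℕₚ.m+n∸n≡m k (numCycles (prodTr ts ⟨$⟩ʳ_)))

InΣ⇒nest : ∀ {ts : Vec (Tr (suc m)) k} → AllPairs (λ t u → proj₁ t F.≤ proj₁ u) ts →
           InΣ (suc m) k ts → AllPairs Nest ts
InΣ⇒nest {m} {k} {ts} ss (os , norm≡k , le) =
  tight⇒nest c-injective os ss (All.universal c-follows ts)
    (trans cuts (sym (trans (cong (k +_) (numCycles-c {m})) (ℕₚ.+-comm k 1))))
  where
  open ≡-Reasoning
  q = numCycles (cut ts c)
  total : m ≡ k + (suc m ∸ q)
  total = trans (cong (suc m ∸_) (sym (numCycles-c {m})))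
    (trans le (cong₂ _+_ norm≡k (norm-cong {suc m} (flip-prodTr ts c))))
  -- `numCycles≤n` undoes the truncated subtraction in `norm`.
  cuts : q ≡ suc k
  cuts = ℕₚ.+-cancelʳ-≡ (suc m ∸ q) q (suc k) (trans (ℕₚ.m+[n∸m]≡n (numCycles≤n (cut ts c))) (cong suc total))

-- Subsets

x∉p-x : ∀ (p : Subset n) x → x ∉ p - x
x∉p-x (s ∷ p) zero    ()
x∉p-x (s ∷ p) (suc x) (there x∈) = x∉p-x p x x∈

∈-remove⁻ : ∀ (p : Subset n) {x y} → x ∈ p - y → x ∈ p × x ≢ y
∈-remove⁻ p {x} {y} x∈ = Subₚ.p─q⊆p p ⁅ y ⁆ x∈ , λ { refl → x∉p-x p x x∈ }

∣p∣≡1+∣p-x∣ : ∀ {p : Subset n} {x} → x ∈ p → ∣ p ∣ ≡ suc ∣ p - x ∣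
∣p∣≡1+∣p-x∣ {p = inside ∷ p} here = cong (λ q → suc ∣ q ∣) (sym (Subₚ.p─⊥≡p p))
∣p∣≡1+∣p-x∣ {p = inside  ∷ p} (there x∈) = cong suc (∣p∣≡1+∣p-x∣ x∈)
∣p∣≡1+∣p-x∣ {p = outside ∷ p} (there x∈) = ∣p∣≡1+∣p-x∣ x∈

0<∣p∣⇒nonempty : ∀ {p : Subset n} → 0 < ∣ p ∣ → Nonempty p
0<∣p∣⇒nonempty {n} {p} lt with Subₚ.nonempty? p
... | yes ne = ne
... | no  ¬ne = contradiction lt (ℕₚ.<-irrefl
      (sym (trans (cong ∣_∣ (Subₚ.Empty-unique ¬ne)) (Subₚ.∣⊥∣≡0 n))))

∣p∣≡1⇒singleton : ∀ {p : Subset n} {x} → ∣ p ∣ ≡ 1 → x ∈ p → p ≡ ⁅ x ⁆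
∣p∣≡1⇒singleton {p = p} {x} eq x∈ = Subₚ.⊆-antisym to from
  where
  to : p Sub.⊆ ⁅ x ⁆
  to {y} y∈ with y F.≟ x
  ... | yes refl = Subₚ.x∈⁅x⁆ x
  ... | no  y≢x  = case trans (sym eq) (trans (∣p∣≡1+∣p-x∣ x∈)
          (cong suc (∣p∣≡1+∣p-x∣ (Subₚ.x∈p∧x≢y⇒x∈p-y y∈ y≢x)))) of λ ()
  from : ⁅ x ⁆ Sub.⊆ p
  from y∈ rewrite Subₚ.x∈⁅y⁆⇒x≡y x y∈ = x∈

remove-injective : ∀ {p q : Subset n} {x} → x ∈ p → x ∈ q → p - x ≡ q - x → p ≡ q
remove-injective {n} x∈p x∈q eq = Subₚ.⊆-antisym (half x∈q eq) (half x∈p (sym eq))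
  where
  half : ∀ {p q : Subset n} {x} → x ∈ q → p - x ≡ q - x → p Sub.⊆ q
  half {p} {q} {x} x∈q eq {y} y∈ with y F.≟ x
  ... | yes refl = x∈q
  ... | no  y≢x  = proj₁ (∈-remove⁻ q (subst (y ∈_) eq (Subₚ.x∈p∧x≢y⇒x∈p-y y∈ y≢x)))

∈-image⁺ : ∀ (f : Fin n → Fin n) {B x} → x ∈ B → f x ∈ image f B
∈-image⁺ {n} f {B} {x} x∈ = Vₚ.lookup⇒[]= (f x) _ (trans (Vₚ.lookup∘tabulate _ (f x))
  (Equivalence.to T-≡ (LAnyₚ.any⁺ (λ z → does (z Subₚ.∈? B) ∧ does (f z F.≟ f x))
    (LAny.map (λ { refl → Equivalence.from T-∧
      ( Equivalence.from T-≡ (dec-true (x Subₚ.∈? B) x∈)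
      , Equivalence.from T-≡ (dec-true (f x F.≟ f x) refl)) }) (∈-allFin x)))))

T-does : ∀ {P : Set} (p : Dec P) → T (does p) → P
T-does (yes p) _ = p

∈-image⁻ : ∀ (f : Fin n → Fin n) {B y} → y ∈ image f B → ∃ λ x → x ∈ B × f x ≡ y
∈-image⁻ {n} f {B} {y} y∈ with LAny.satisfied (LAnyₚ.any⁻ _ (allFin n)
  (Equivalence.from T-≡ (trans (sym (Vₚ.lookup∘tabulate _ y)) (Vₚ.[]=⇒lookup y∈))))
... | x , t = let a , b = Equivalence.to (T-∧ {does (x Subₚ.∈? B)}) t in
  x , T-does (x Subₚ.∈? B) a , T-does (f x F.≟ y) b

module _ {f : Fin n → Fin n} (f-inj : Injective _≡_ _≡_ f) where

  ∈-image-injective : ∀ {B x} → f x ∈ image f B → x ∈ B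
  ∈-image-injective fx∈ with ∈-image⁻ f fx∈
  ... | y , y∈ , eq rewrite f-inj eq = y∈

  image-remove : ∀ B x → image f B - f x ≡ image f (B - x)
  image-remove B x = Subₚ.⊆-antisym to from
    where
    to : image f B - f x Sub.⊆ image f (B - x)
    to z∈ with ∈-remove⁻ (image f B) z∈
    ... | z∈im , z≢ with ∈-image⁻ f z∈im
    ... | y , y∈ , refl = ∈-image⁺ f (Subₚ.x∈p∧x≢y⇒x∈p-y y∈ (z≢ ∘ cong f))
    from : image f (B - x) Sub.⊆ image f B - f x
    from z∈ with ∈-image⁻ f z∈
    ... | y , y∈ , refl = let y∈B , y≢x = ∈-remove⁻ B y∈ in
      Subₚ.x∈p∧x≢y⇒x∈p-y (∈-image⁺ f y∈B) (y≢x ∘ f-inj)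

  ∣image∣ : ∀ B → ∣ image f B ∣ ≡ ∣ B ∣
  ∣image∣ B = go ∣ B ∣ B refl
    where
    go : ∀ j B → ∣ B ∣ ≡ j → ∣ image f B ∣ ≡ j
    go zero B eq with Subₚ.nonempty? (image f B)
    ... | yes (y , y∈) = let x , x∈ , _ = ∈-image⁻ f y∈ in
            case trans (sym (∣p∣≡1+∣p-x∣ x∈)) eq of λ ()
    ... | no ¬ne = trans (cong ∣_∣ (Subₚ.Empty-unique ¬ne)) (Subₚ.∣⊥∣≡0 n)
    go (suc j) B eq with 0<∣p∣⇒nonempty {p = B} (subst (0 <_) (sym eq) (s≤s z≤n))
    ... | x , x∈ = trans (∣p∣≡1+∣p-x∣ (∈-image⁺ f x∈)) (cong suc
            (trans (cong ∣_∣ (image-remove B x))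
              (go j (B - x) (ℕₚ.suc-injective (trans (sym (∣p∣≡1+∣p-x∣ x∈)) eq)))))

-- Parking

-- The exponent is `suc s` because the search starts one step past e; a car takes the spot e itself
-- only after a full turn.
FirstHit : Subset n → Fin n → Fin n → Set
FirstHit R e p = ∃ λ s → c^ (suc s) e ≡ p × p ∈ R × (∀ t → t < s → c^ (suc t) e ∉ R)

firstHit-unique : ∀ {R : Subset n} {e p q} → FirstHit R e p → FirstHit R e q → p ≡ q
firstHit-unique (s , refl , p∈ , p-least) (t , refl , q∈ , q-least) with ℕₚ.<-cmp s t
... | tri< s<t _ _  = contradiction p∈ (q-least s s<t)
... | tri≈ _ refl _ = refl
... | tri> _ _ t<s  = contradiction q∈ (p-least t t<s)

c-transitive : (x y : Fin n) → Orbit c x y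
c-transitive {suc m} x y = orbit-trans (to-zero x) (orbit-sym c-injective (to-zero y))
  where
  to-zero : ∀ x → Orbit c x zero
  to-zero x = suc m ∸ toℕ x , trans (sym (c^-≡-iter (suc m ∸ toℕ x) x)) (c^-zero x)

c^-suc : ∀ s (x : Fin n) → c^ (suc s) x ≡ c^ s (c x)
c^-suc zero    x = refl
c^-suc (suc s) x = cong c (c^-suc s x)

-- The invariant of the search: the exponents 1, ..., j have failed and the list goes on with j + 1,
-- j + 2, .... The function f is arbitrary so as to follow the recursion of `applyUpTo`, which
-- passes to `f ∘ suc`.
firstHit-just : ∀ (R : Subset n) e (f : ℕ → ℕ) j len → (∀ i → f i ≡ suc (j + i)) →
  (∀ t → t < j → c^ (suc t) e ∉ R) → ∀ t → j ≤ t → t < j + len → c^ (suc t) e ∈ R →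
  FirstHit R e (fromMaybe e (firstHit R e (applyUpTo f len)))
firstHit-just R e f j zero feq none t j≤t t<j hit =
  contradiction (subst (t <_) (ℕₚ.+-identityʳ j) t<j) (ℕₚ.≤⇒≯ j≤t)
firstHit-just R e f j (suc len) feq none t j≤t t<j+l hit
  rewrite trans (feq 0) (cong suc (ℕₚ.+-identityʳ j)) with c^ (suc j) e Subₚ.∈? R
... | yes here∈ = j , refl , here∈ , none
... | no  here∉ = firstHit-just R e (f ∘ suc) (suc j) len
        (λ i → trans (feq (suc i)) (cong suc (ℕₚ.+-suc j i)))
        none′ t j<t (subst (t <_) (ℕₚ.+-suc j len) t<j+l) hit
  where
  j<t : j < t
  j<t = ℕₚ.≤∧≢⇒< j≤t λ { refl → here∉ hit }
  none′ : ∀ t → t < suc j → c^ (suc t) e ∉ R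
  none′ t t<1+j with ℕₚ.m<1+n⇒m<n∨m≡n t<1+j
  ... | inj₁ t<j  = none t t<j
  ... | inj₂ refl = here∉

park-firstHit : ∀ {R : Subset n} e → Nonempty R → FirstHit R e (park R e)
park-firstHit {n} {R} e (z , z∈) with orbit-bounded c-injective (c-transitive (c e) z)
... | t , t<n , eq = subst (λ ss → FirstHit R e (fromMaybe e (firstHit R e ss))) (sym (Lₚ.map-upTo suc n))
  (firstHit-just R e suc 0 n (λ _ → refl) (λ _ ()) t z≤n t<n
    (subst (_∈ R) (trans (sym eq) (trans (sym (c^-≡-iter t (c e))) (sym (c^-suc t e)))) z∈))

park-unique : ∀ {R : Subset n} {e p} → FirstHit R e p → park R e ≡ p
park-unique {e = e} hit@(_ , _ , p∈ , _) = firstHit-unique (park-firstHit e (_ , p∈)) hit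

park-∈ : ∀ {R : Subset n} e → Nonempty R → park R e ∈ R
park-∈ e ne = proj₁ (proj₂ (proj₂ (park-firstHit e ne)))

rem : Subset n → Vec (Fin n) k → Subset n
rem O E = proj₂ (parkAll O E)

rem-⊆ : ∀ {O : Subset n} (E : Vec (Fin n) k) → rem O E Sub.⊆ O
rem-⊆ []       x∈ = x∈
rem-⊆ (e ∷ es) x∈ = rem-⊆ es (Subₚ.p─q⊆p _ _ x∈)

∣rem∣ : ∀ {O : Subset n} (E : Vec (Fin n) k) → k ≤ ∣ O ∣ → k + ∣ rem O E ∣ ≡ ∣ O ∣
∣rem∣ []       le = refl
∣rem∣ {k = suc k} {O} (e ∷ es) le = trans (sym (ℕₚ.+-suc k _))
  (trans (cong (k +_) (sym (∣p∣≡1+∣p-x∣ {p = rem O es} (park-∈ e (0<∣p∣⇒nonempty pos))))) ih)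
  where
  ih = ∣rem∣ es (ℕₚ.≤-trans (ℕₚ.n≤1+n k) le)
  pos : 0 < ∣ rem O es ∣
  pos = ℕₚ.+-cancelˡ-< k _ _ (subst₂ _<_ (sym (ℕₚ.+-identityʳ k)) (sym ih) le)

rem-nonempty : ∀ {O : Subset n} (E : Vec (Fin n) k) → k < ∣ O ∣ → Nonempty (rem O E)
rem-nonempty {k = k} E lt = 0<∣p∣⇒nonempty (ℕₚ.+-cancelˡ-< k _ _
  (subst₂ _<_ (sym (ℕₚ.+-identityʳ k)) (sym (∣rem∣ E (ℕₚ.<⇒≤ lt))) lt))

firstHit-remove : ∀ {R : Subset n} {e p q} → q ≢ p → FirstHit R e q → FirstHit (R - p) e q
firstHit-remove {R = R} q≢p (s , eq , q∈ , least) =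
  s , eq , Subₚ.x∈p∧x≢y⇒x∈p-y q∈ q≢p , λ t t<s x∈ → least t t<s (proj₁ (∈-remove⁻ R x∈))

-- A car that finds p taken has met no free spot before p, so it drives on as if it had started at
-- p.
firstHit-continue : ∀ {R : Subset n} {e p r} → FirstHit R e p → FirstHit (R - p) p r → FirstHit (R - p) e r
firstHit-continue {R = R} {e} {p} (s , refl , p∈ , least) (t , refl , r∈ , least′) =
  t + suc s , c^-+ (suc t) (suc s) e , r∈ , none
  where
  none : ∀ u → u < t + suc s → c^ (suc u) e ∉ R - p
  none u u<t+s u∈ with ℕₚ.<-cmp u s
  ... | tri< u<s _ _  = least u u<s (proj₁ (∈-remove⁻ R u∈))
  ... | tri≈ _ refl _ = x∉p-x R _ u∈
  ... | tri> _ _ s<u  = least′ (u ∸ suc s)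
          (ℕₚ.+-cancelʳ-< (suc s) _ _ (subst (_< t + suc s) (sym (ℕₚ.m∸n+n≡m s<u)) u<t+s))
          (subst (_∈ R - p) (trans (cong (λ v → c^ (suc v) e) (sym (ℕₚ.m∸n+n≡m s<u)))
            (c^-+ (suc (u ∸ suc s)) (suc s) e)) u∈)

-- Cars that want different spots do not disturb each other. If both want the same spot, whichever
-- comes second continues from there, so the same two spots are filled in either order.
park-swap : ∀ {R : Subset n} x y → 1 < ∣ R ∣ →
  R - park R y - park (R - park R y) x ≡ R - park R x - park (R - park R x) y
park-swap {R = R} x y lt with park R x F.≟ park R y
... | yes eq = trans (cong (λ z → R - p - z) p′≡) (trans (cong (λ w → R - w - r) (sym eq))
        (cong (λ z → R - q - z) (sym q′≡)))
  where
  p = park R y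
  q = park R x
  ne : Nonempty R
  ne = 0<∣p∣⇒nonempty (ℕₚ.<-trans (s≤s z≤n) lt)
  ne′ : Nonempty (R - p)
  ne′ = 0<∣p∣⇒nonempty (s≤s⁻¹ (subst (1 <_) (∣p∣≡1+∣p-x∣ (park-∈ y ne)) lt))
  r = park (R - p) p
  p′≡ : park (R - p) x ≡ r
  p′≡ = park-unique (firstHit-continue (subst (FirstHit R x) eq (park-firstHit x ne)) (park-firstHit p ne′))
  q′≡ : park (R - q) y ≡ r
  q′≡ = trans (cong (λ w → park (R - w) y) eq)
    (park-unique (firstHit-continue (park-firstHit y ne) (park-firstHit p ne′)))
... | no x≢y = trans (cong (λ z → R - p - z) p′≡) (trans (Subₚ.p─x─y≡p─y─x R p q)
        (cong (λ z → R - q - z) (sym q′≡)))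
  where
  p = park R y
  q = park R x
  ne : Nonempty R
  ne = 0<∣p∣⇒nonempty (ℕₚ.<-trans (s≤s z≤n) lt)
  p′≡ : park (R - p) x ≡ q
  p′≡ = park-unique (firstHit-remove x≢y (park-firstHit x ne))
  q′≡ : park (R - q) y ≡ p
  q′≡ = park-unique (firstHit-remove (x≢y ∘ sym) (park-firstHit y ne))

rem-actAdj : ∀ {O : Subset n} l (E : Vec (Fin n) k) → k < ∣ O ∣ →
             rem O (actAdj swapPair l E) ≡ rem O E
rem-actAdj zero    []           lt = refl
rem-actAdj zero    (x ∷ [])     lt = refl
rem-actAdj {k = suc (suc k)} {O} zero (x ∷ y ∷ es) lt = park-swap y x (ℕₚ.+-cancelˡ-< k _ _
  (subst₂ _<_ (ℕₚ.+-comm 1 k) (sym (∣rem∣ es (ℕₚ.≤-trans (ℕₚ.m≤n+m k 3) lt)))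
    (ℕₚ.≤-trans (ℕₚ.n≤1+n (suc (suc k))) lt)))
rem-actAdj (suc l) []           lt = refl
rem-actAdj (suc l) (x ∷ es)     lt =
  cong (λ R → R - park R x) (rem-actAdj l es (ℕₚ.<-trans (ℕₚ.n<1+n _) lt))

firstHit-shift : ∀ {R : Subset n} {e p} → FirstHit R e p → FirstHit (image c R) (c e) (c p)
firstHit-shift {R = R} {e} (s , refl , p∈ , least) = s , sym (c^-suc (suc s) e) , ∈-image⁺ c p∈ ,
  λ t t<s x∈ → least t t<s (∈-image-injective c-injective (subst (_∈ image c R) (sym (c^-suc (suc t) e)) x∈))

rem-shift : ∀ {O : Subset n} (E : Vec (Fin n) k) → k < ∣ O ∣ → rem (image c O) (V.map c E) ≡ image c (rem O E)
rem-shift []       lt = refl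
rem-shift {O = O} (e ∷ es) lt = begin
  rem (image c O) (V.map c es) - park (rem (image c O) (V.map c es)) (c e)
    ≡⟨ cong (λ S → S - park S (c e)) (rem-shift {O = O} es lt′) ⟩
  image c R - park (image c R) (c e)
    ≡⟨ cong (image c R -_) (park-unique (firstHit-shift (park-firstHit e (rem-nonempty es lt′)))) ⟩
  image c R - c (park R e)
    ≡⟨ image-remove c-injective R (park R e) ⟩
  image c (R - park R e) ∎
  where
  open ≡-Reasoning
  R = rem O es
  lt′ = ℕₚ.<-trans (ℕₚ.n<1+n _) lt

-- The process can be run backwards: the spot of the last car to park is known, and putting it back
-- restores the set that this car faced.
parkAll-injective : ∀ {O O′ : Subset n} (E : Vec (Fin n) k) → k < ∣ O ∣ → k < ∣ O′ ∣ →
                    Π E O ≡ Π E O′ → rem O E ≡ rem O′ E → O ≡ O′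
parkAll-injective []       _ _ _ eq = eq
parkAll-injective {O = O} {O′} (e ∷ es) lt lt′ ps rs = parkAll-injective es lt₁ lt₁′ (Vₚ.∷-injectiveʳ ps)
  (remove-injective (park-∈ e (rem-nonempty es lt₁))
    (subst (_∈ rem O′ es) (sym p≡) (park-∈ e (rem-nonempty es lt₁′)))
    (trans rs (cong (rem O′ es -_) (sym p≡))))
  where
  lt₁ = ℕₚ.<-trans (ℕₚ.n<1+n _) lt
  lt₁′ = ℕₚ.<-trans (ℕₚ.n<1+n _) lt′
  p≡ : park (rem O es) e ≡ park (rem O′ es) e
  p≡ = Vₚ.∷-injectiveˡ ps

firstIn-singleton : (x : Fin n) → firstIn ⁅ x ⁆ ≡ just x
firstIn-singleton {n} x = go (allFin n) (∈-allFin x)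
  where
  go : ∀ ys → x L∈.∈ ys → L.head (filterᵇ (λ z → does (z Subₚ.∈? ⁅ x ⁆)) ys) ≡ just x
  go (y ∷ ys) x∈ with y Subₚ.∈? ⁅ x ⁆ | x∈
  ... | yes y∈ | _        = cong just (Subₚ.x∈⁅y⁆⇒x≡y x y∈)
  ... | no  y∉ | here refl = contradiction (Subₚ.x∈⁅x⁆ x) y∉
  ... | no  _  | there x∈  = go ys x∈

-- Parking functions with residue 0

-- The linear form of `FirstHit`, for a car that does not drive past n. That j itself lies in R is
-- stated separately.
Next : Subset n → Fin n → Fin n → Set
Next R i j = i F.< j × (∀ {z} → z ∈ R → i F.< z → j F.≤ z)

c^-to : ∀ {x y : Fin n} → x F.< y → c^ (suc (toℕ y ∸ suc (toℕ x))) x ≡ y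
c^-to {n} {x} {y} x<y = Fₚ.toℕ-injective (trans
  (c^-below (suc d) x (subst (_< n) (sym sum) (Fₚ.toℕ<n y))) sum)
  where
  d = toℕ y ∸ suc (toℕ x)
  sum : suc d + toℕ x ≡ toℕ y
  sum = trans (sym (ℕₚ.+-suc d (toℕ x))) (ℕₚ.m∸n+n≡m x<y)

-- A car that does not wrap around never meets the unused spot 0.
firstHit⇒next : ∀ {R : Subset (suc m)} {i j} → zero ∈ R → j ≢ zero → FirstHit R i j → Next R i j
firstHit⇒next {m} {R} {i} {j} 0∈ j≢0 (s , eq , j∈ , least) with suc s + toℕ i ℕₚ.<? suc m
... | yes lt = ℕₚ.≤-trans (s≤s (ℕₚ.m≤n+m (toℕ i) s)) (ℕₚ.≤-reflexive (sym j≡)) , bound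
  where
  j≡ : toℕ j ≡ suc s + toℕ i
  j≡ = trans (cong toℕ (sym eq)) (c^-below (suc s) i lt)
  bound : ∀ {z} → z ∈ R → i F.< z → j F.≤ z
  bound {z} z∈ i<z = ℕₚ.≮⇒≥ λ z<j → least (toℕ z ∸ suc (toℕ i))
    (ℕₚ.+-cancelʳ-< (suc (toℕ i)) _ _ (subst₂ _<_ (sym (ℕₚ.m∸n+n≡m i<z))
      (trans j≡ (sym (ℕₚ.+-suc s (toℕ i)))) z<j))
    (subst (_∈ R) (sym (c^-to i<z)) z∈)
-- A car that reaches or passes the end of the line meets the free spot `zero` after `suc t` steps.
-- If t < s this contradicts `least`; if t = s it makes j equal to `zero`.
... | no ge = contradiction (wraps (ℕₚ.m≤n⇒m<n∨m≡n t≤s)) λ ()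
  where
  t = m ∸ toℕ i
  1+t≡ : suc t ≡ suc m ∸ toℕ i
  1+t≡ = sym (ℕₚ.+-∸-assoc 1 (s≤s⁻¹ (Fₚ.toℕ<n i)))
  t≤s : t ≤ s
  t≤s = s≤s⁻¹ (subst (_≤ suc s) (sym 1+t≡) (ℕₚ.m≤n+o⇒m∸n≤o _ (toℕ i)
    (subst (suc m ≤_) (ℕₚ.+-comm (suc s) (toℕ i)) (ℕₚ.≮⇒≥ ge))))
  at-zero : c^ (suc t) i ≡ zero
  at-zero = trans (cong (λ u → c^ u i) 1+t≡) (c^-zero i)
  wraps : t < s ⊎ t ≡ s → 1 ≡ 0
  wraps (inj₁ t<s) = contradiction (subst (_∈ R) (sym at-zero) 0∈) (least t t<s)
  wraps (inj₂ t≡s) = contradiction (trans (sym eq) (trans (cong (λ u → c^ (suc u) i) (sym t≡s)) at-zero)) j≢0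

next⇒firstHit : ∀ {R : Subset n} {i j} → j ∈ R → Next R i j → FirstHit R i j
next⇒firstHit {n} {R} {i} {j} j∈ (i<j , bound) = s , c^-to i<j , j∈ , none
  where
  s = toℕ j ∸ suc (toℕ i)
  none : ∀ t → t < s → c^ (suc t) i ∉ R
  none t t<s x∈ = ℕₚ.<⇒≱ x<j (bound x∈ (subst (toℕ i <_) (sym x≡) (s≤s (ℕₚ.m≤n+m (toℕ i) t))))
    where
    t+i<j : suc t + toℕ i < toℕ j
    t+i<j = subst₂ _<_ (ℕₚ.+-suc t (toℕ i)) (ℕₚ.m∸n+n≡m i<j) (ℕₚ.+-monoˡ-< (suc (toℕ i)) t<s)
    x≡ : toℕ (c^ (suc t) i) ≡ suc t + toℕ i
    x≡ = c^-below (suc t) i (ℕₚ.<-trans t+i<j (Fₚ.toℕ<n j))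
    x<j : c^ (suc t) i F.< j
    x<j = subst (_< toℕ j) (sym x≡) t+i<j

-- The second half of `Nest t u` is `Clear (proj₂ t) u`. In terms of parking, no car reaches or
-- passes the free spot z from below.
Clear : Fin n → Tr n → Set
Clear z (i , j) = i F.< z → j F.< z

module _ {m} {O : Subset (suc m)} where

  park-next : ∀ e (es : Vec (Fin (suc m)) k) → zero ∈ rem O (e ∷ es) →
              zero ∈ rem O es × Next (rem O es) e (park (rem O es) e)
  park-next e es 0∈ = let 0∈R , 0≢p = ∈-remove⁻ (rem O es) 0∈ in
    0∈R , firstHit⇒next 0∈R (0≢p ∘ sym) (park-firstHit e (zero , 0∈R))

  park-ordered : (E : Vec (Fin (suc m)) k) → zero ∈ rem O E → All IsTransposition (zipWith _,_ E (Π E O))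
  park-ordered []       0∈ = []
  park-ordered (e ∷ es) 0∈ = let 0∈R , e<p , _ = park-next e es 0∈ in e<p ∷ park-ordered es 0∈R

  -- A spot that is free at the end was free all along, so a car starting below it stopped before
  -- it.
  park-clear : (E : Vec (Fin (suc m)) k) → zero ∈ rem O E → ∀ {z} → z ∈ rem O E →
               All (Clear z) (zipWith _,_ E (Π E O))
  park-clear []       0∈ z∈ = []
  park-clear (e ∷ es) 0∈ z∈ =
    let 0∈R , _ , next = park-next e es 0∈
        z∈R , z≢p      = ∈-remove⁻ (rem O es) z∈
    in (λ e<z → Fₚ.≤∧≢⇒< (next z∈R e<z) (z≢p ∘ sym)) ∷ park-clear es 0∈R z∈R

  -- Cars park from the right end of the sequence, so the spot of e is still free after all of `es`
  -- have parked, and `park-clear` applies to it.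
  park-nest : (E : Vec (Fin (suc m)) k) → AllPairs F._≤_ E → zero ∈ rem O E →
              AllPairs Nest (zipWith _,_ E (Π E O))
  park-nest []       []       0∈ = []
  park-nest (e ∷ es) (s ∷ ss) 0∈ = let 0∈R , _ = park-next e es 0∈ in
    both _,_ (All-zip₁ s (Π es O)) (park-clear es 0∈R (park-∈ e (zero , 0∈R))) ∷ park-nest es ss 0∈R
    where
    All-zip₁ : ∀ {A : Set} {P : A → Set} {k} {xs : Vec A k} → All P xs → ∀ ys →
               All (P ∘ proj₁ {B = λ _ → A}) (zipWith _,_ xs ys)
    All-zip₁ []       []       = []
    All-zip₁ (p ∷ ps) (y ∷ ys) = p ∷ All-zip₁ ps ys

-- Recovering the set of spots from a nested sequence

Fresh : Fin n → Tr n → Set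
Fresh z t = z ≢ proj₂ t

nest-fresh : ∀ {t u : Tr n} → IsTransposition u → Nest t u → Fresh (proj₂ t) u
nest-fresh iu<ju (_ , nest) refl = ℕₚ.<-irrefl refl (nest iu<ju)

parkAll-nest : ∀ {O : Subset n} (ts : Vec (Tr n) k) → All IsTransposition ts → AllPairs Nest ts →
  All (λ t → proj₂ t ∈ O) ts → (∀ {z} → z ∈ O → All (Fresh z) ts → All (Clear z) ts) →
  Π (V.map proj₁ ts) O ≡ V.map proj₂ ts ×
  (∀ {z} → z ∈ O → All (Fresh z) ts → z ∈ rem O (V.map proj₁ ts)) ×
  (∀ {z} → z ∈ rem O (V.map proj₁ ts) → All (Fresh z) ts)
parkAll-nest [] [] [] [] clear = refl , (λ z∈ _ → z∈) , λ _ → []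
parkAll-nest {n = n} {O = O} (t@(i , j) ∷ ts) (o ∷ os) (ns ∷ nss) (j∈ ∷ js∈) clear
  with parkAll-nest ts os nss js∈ clear′
  where
  clear′ : ∀ {z} → z ∈ O → All (Fresh z) ts → All (Clear z) ts
  clear′ {z} z∈ fresh with z F.≟ j
  ... | yes refl = All.map proj₂ ns
  ... | no  z≢j  = All.tail (clear z∈ (z≢j ∷ fresh))
... | ps , keep , gone = cong₂ _∷_ parked ps , keep′ , gone′
  where
  R = rem O (V.map proj₁ ts)
  next : ∀ {z} → z ∈ R → i F.< z → j F.≤ z
  next {z} z∈ i<z with z F.≟ j
  ... | yes refl = ℕₚ.≤-refl
  ... | no  z≢j  = ℕₚ.<⇒≤ (All.head (clear (rem-⊆ (V.map proj₁ ts) z∈) (z≢j ∷ gone z∈)) i<z)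
  parked : park R i ≡ j
  parked = park-unique (next⇒firstHit (keep j∈ (both nest-fresh os ns)) (o , next))
  keep′ : ∀ {z} → z ∈ O → All (Fresh z) (t ∷ ts) → z ∈ R - park R i
  keep′ z∈ (z≢j ∷ fresh) = Subₚ.x∈p∧x≢y⇒x∈p-y (keep z∈ fresh) λ eq → z≢j (trans eq parked)
  gone′ : ∀ {z} → z ∈ R - park R i → All (Fresh z) (t ∷ ts)
  gone′ z∈ = let z∈R , z≢p = ∈-remove⁻ R z∈ in (λ eq → z≢p (trans eq (sym parked))) ∷ gone z∈R

spots : Vec (Tr (suc m)) k → Subset (suc m)
spots []       = ⁅ zero ⁆
spots (t ∷ ts) = ⁅ proj₂ t ⁆ ∪ spots ts

zero∈spots : (ts : Vec (Tr (suc m)) k) → zero ∈ spots ts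
zero∈spots []       = Subₚ.x∈⁅x⁆ zero
zero∈spots (t ∷ ts) = Subₚ.q⊆p∪q ⁅ proj₂ t ⁆ (spots ts) (zero∈spots ts)

∈-spots : (ts : Vec (Tr (suc m)) k) → All (λ t → proj₂ t ∈ spots ts) ts
∈-spots []       = []
∈-spots (t ∷ ts) = Subₚ.p⊆p∪q (spots ts) (Subₚ.x∈⁅x⁆ (proj₂ t)) ∷
  All.map (Subₚ.q⊆p∪q ⁅ proj₂ t ⁆ (spots ts)) (∈-spots ts)

fresh-spot : ∀ {ts : Vec (Tr (suc m)) k} {z} → z ∈ spots ts → All (Fresh z) ts → z ≡ zero
fresh-spot z∈ [] = Subₚ.x∈⁅y⁆⇒x≡y zero z∈
fresh-spot {ts = t ∷ ts} z∈ (f ∷ fs) with Subₚ.x∈p∪q⁻ ⁅ proj₂ t ⁆ (spots ts) z∈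
... | inj₁ z∈j = contradiction (Subₚ.x∈⁅y⁆⇒x≡y (proj₂ t) z∈j) f
... | inj₂ z∈s = fresh-spot z∈s fs

∣spots∣ : ∀ {ts : Vec (Tr (suc m)) k} → All IsTransposition ts → AllPairs Nest ts → ∣ spots ts ∣ ≡ suc k
∣spots∣ {m} [] [] = Subₚ.∣⁅x⁆∣≡1 {suc m} zero
∣spots∣ {ts = (i , j) ∷ ts} (o ∷ os) (ns ∷ nss) =
  trans (∣p∣≡1+∣p-x∣ j∈) (cong suc (trans (cong ∣_∣ (Subₚ.⊆-antisym to from)) (∣spots∣ os nss)))
  where
  j∈ : j ∈ ⁅ j ⁆ ∪ spots ts
  j∈ = Subₚ.p⊆p∪q (spots ts) (Subₚ.x∈⁅x⁆ j)
  j∉ : j ∉ spots ts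
  j∉ j∈s = ℕₚ.n≮0 (subst (toℕ i <_) (cong toℕ (fresh-spot j∈s (both nest-fresh os ns))) o)
  to : (⁅ j ⁆ ∪ spots ts) - j Sub.⊆ spots ts
  to z∈ with ∈-remove⁻ (⁅ j ⁆ ∪ spots ts) z∈
  ... | z∈∪ , z≢j with Subₚ.x∈p∪q⁻ ⁅ j ⁆ (spots ts) z∈∪
  ... | inj₁ z∈j = contradiction (Subₚ.x∈⁅y⁆⇒x≡y j z∈j) z≢j
  ... | inj₂ z∈s = z∈s
  from : spots ts Sub.⊆ (⁅ j ⁆ ∪ spots ts) - j
  from z∈ = Subₚ.x∈p∧x≢y⇒x∈p-y (Subₚ.q⊆p∪q ⁅ j ⁆ (spots ts) z∈) λ { refl → j∉ z∈ }

-- The only spot that occurs as no j is `zero`, and no car starts below it, so the clearance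
-- hypothesis holds vacuously.
park-spots : ∀ {ts : Vec (Tr (suc m)) k} → All IsTransposition ts → AllPairs Nest ts →
  Π (V.map proj₁ ts) (spots ts) ≡ V.map proj₂ ts × rem (spots ts) (V.map proj₁ ts) ≡ ⁅ zero ⁆
park-spots {m} {k} {ts} os ns with parkAll-nest ts os ns (∈-spots ts)
  (λ z∈ fresh → All.universal (λ t i<z → contradiction (subst (toℕ (proj₁ t) <_)
    (cong toℕ (fresh-spot z∈ fresh)) i<z) λ ()) ts)
... | ps , keep , gone = ps , Subₚ.⊆-antisym to from
  where
  to : rem (spots ts) (V.map proj₁ ts) Sub.⊆ ⁅ zero ⁆
  to z∈ rewrite fresh-spot (rem-⊆ (V.map proj₁ ts) z∈) (gone z∈) = Subₚ.x∈⁅x⁆ zero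
  from : ⁅ zero ⁆ Sub.⊆ rem (spots ts) (V.map proj₁ ts)
  from z∈ rewrite Subₚ.x∈⁅y⁆⇒x≡y zero z∈ = keep (zero∈spots ts)
    (All.map (λ {t} i<j 0≡j → ℕₚ.n≮0 (subst (toℕ (proj₁ t) <_) (cong toℕ (sym 0≡j)) i<j)) os)

-- The Hurwitz action

<ᵇ-true : ∀ {a b} → a < b → (a <ᵇ b) ≡ true
<ᵇ-true {a} {b} lt = dec-true (a ℕₚ.<? b) lt

<ᵇ-false : ∀ {a b} → b ≤ a → (a <ᵇ b) ≡ false
<ᵇ-false {a} {b} le = dec-false (a ℕₚ.<? b) (ℕₚ.≤⇒≯ le)

module _ {g h : Tr n} (og : IsTransposition g) (oh : IsTransposition h) (g<h : proj₁ g F.< proj₁ h) where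

  act-fixes : act h (proj₁ g) ≡ proj₁ g
  act-fixes = swap⇒act h (fixed (Fₚ.<⇒≢ g<h) (Fₚ.<⇒≢ (ℕₚ.<-trans g<h oh)))

  act-above : proj₁ g F.< act h (proj₂ g)
  act-above = swap-preserves (proj₁ g F.<_) (λ _ → ℕₚ.<-trans g<h oh) (λ _ → g<h) (act-swap h (proj₂ g)) og

  -- As i_g < i_h < j_h, the transposition h fixes i_g and cannot bring j_g down to i_g; so i_g
  -- remains the smaller endpoint.
  conj-≡ : conj h g ≡ (proj₁ g , act h (proj₂ g))
  conj-≡ rewrite act-fixes | <ᵇ-true act-above = refl

conj-involutive : ∀ {g h : Tr n} → IsTransposition g → IsTransposition h → proj₁ g F.< proj₁ h →
                  conj h (conj h g) ≡ g
conj-involutive {g = g} {h} og oh g<h = trans (cong (conj h) (conj-≡ og oh g<h))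
  (trans (conj-≡ (act-above og oh g<h) oh g<h) (cong (proj₁ g ,_) (act-involutive h (proj₂ g))))

act-conj : ∀ {g h : Tr n} → IsTransposition g → IsTransposition h → proj₁ g F.< proj₁ h →
           ∀ x → act (conj h g) (act h x) ≡ act h (act g x)
act-conj {g = g} {h} og oh g<h x = trans (cong (λ t → act t (act h x)) (conj-≡ og oh g<h))
  (swap⇒act (proj₁ g , act h (proj₂ g)) (subst (λ a → Swap a (act h (proj₂ g)) (act h x) (act h (act g x))) (act-fixes og oh g<h)
    (swap-map (act-swap g x))))
  where
  swap-map : ∀ {a b u v} → Swap a b u v → Swap (act h a) (act h b) (act h u) (act h v)
  swap-map (fixed ≢a ≢b) = fixed (≢a ∘ act-injective h) (≢b ∘ act-injective h)
  swap-map a↦b           = a↦b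
  swap-map b↦a           = b↦a

data Hurwitz {n} (g h : Tr n) : Tr n × Tr n → Set where
  equal : proj₁ g ≡ proj₁ h → Hurwitz g h (g , h)
  below : proj₁ g F.< proj₁ h → Hurwitz g h (h , conj h g)
  above : proj₁ h F.< proj₁ g → Hurwitz g h (conj g h , g)

hurwitz-view : (g h : Tr n) → Hurwitz g h (hurwitz g h)
hurwitz-view g h = cases (Fₚ.<-cmp (proj₁ g) (proj₁ h))
  where
  branch : Bool → Bool → Tr _ × Tr _
  branch e l = if e then (g , h) else if l then (h , conj h g) else (conj g h , g)
  cases : Tri (proj₁ g F.< proj₁ h) (proj₁ g ≡ proj₁ h) (proj₁ h F.< proj₁ g) → Hurwitz g h (hurwitz g h)
  cases (tri< lt neq _) = subst (Hurwitz g h)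
    (sym (cong₂ branch (dec-false (proj₁ g F.≟ proj₁ h) neq) (<ᵇ-true lt))) (below lt)
  cases (tri≈ _ eq _)   = subst (Hurwitz g h)
    (sym (cong (λ e → branch e (toℕ (proj₁ g) <ᵇ toℕ (proj₁ h))) (dec-true (proj₁ g F.≟ proj₁ h) eq))) (equal eq)
  cases (tri> _ neq gt) = subst (Hurwitz g h)
    (sym (cong₂ branch (dec-false (proj₁ g F.≟ proj₁ h) neq) (<ᵇ-false (ℕₚ.<⇒≤ gt)))) (above gt)

hurwitz-unique : ∀ {g h : Tr n} {p q} → Hurwitz g h p → Hurwitz g h q → p ≡ q
hurwitz-unique (equal _)  (equal _)  = refl
hurwitz-unique (equal eq) (below lt) = contradiction eq (Fₚ.<⇒≢ lt)
hurwitz-unique (equal eq) (above gt) = contradiction (sym eq) (Fₚ.<⇒≢ gt)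
hurwitz-unique (below lt) (equal eq) = contradiction eq (Fₚ.<⇒≢ lt)
hurwitz-unique (below _)  (below _)  = refl
hurwitz-unique (below lt) (above gt) = contradiction lt (ℕₚ.<-asym gt)
hurwitz-unique (above gt) (equal eq) = contradiction (sym eq) (Fₚ.<⇒≢ gt)
hurwitz-unique (above gt) (below lt) = contradiction lt (ℕₚ.<-asym gt)
hurwitz-unique (above _)  (above _)  = refl

module _ {g h : Tr n} (og : IsTransposition g) (oh : IsTransposition h) where

  private
    conj-ordered : ∀ {g h : Tr n} → IsTransposition g → IsTransposition h → proj₁ g F.< proj₁ h →
                   IsTransposition (conj h g)
    conj-ordered og oh g<h = subst IsTransposition (sym (conj-≡ og oh g<h)) (act-above og oh g<h)

    conj-proj₁ : ∀ {g h : Tr n} → IsTransposition g → IsTransposition h → proj₁ g F.< proj₁ h →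
                 proj₁ (conj h g) ≡ proj₁ g
    conj-proj₁ og oh g<h = cong proj₁ (conj-≡ og oh g<h)

  hurwitz-ordered : ∀ {p} → Hurwitz g h p → IsTransposition (proj₁ p) × IsTransposition (proj₂ p)
  hurwitz-ordered (equal _)  = og , oh
  hurwitz-ordered (below lt) = oh , conj-ordered og oh lt
  hurwitz-ordered (above gt) = conj-ordered oh og gt , og

  hurwitz-proj₁ : ∀ {p} → Hurwitz g h p → proj₁ (proj₁ p) ≡ proj₁ h × proj₁ (proj₂ p) ≡ proj₁ g
  hurwitz-proj₁ (equal eq) = eq , sym eq
  hurwitz-proj₁ (below lt) = refl , conj-proj₁ og oh lt
  hurwitz-proj₁ (above gt) = conj-proj₁ oh og gt , refl

  hurwitz-product : ∀ {p} → Hurwitz g h p → ∀ x → act (proj₁ p) (act (proj₂ p) x) ≡ act g (act h x)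
  hurwitz-product (equal _)  x = refl
  hurwitz-product (below lt) x = trans (cong (λ y → act h (act (conj h g) y)) (sym (act-involutive h x)))
    (trans (cong (act h) (act-conj og oh lt (act h x))) (act-involutive h _))
  hurwitz-product (above gt) x = act-conj oh og gt x

  -- Unless they are equal, the smaller endpoints have changed places, so a second application falls
  -- under the opposite case and conjugates back by the same transposition.
  hurwitz-inverse : ∀ {p} → Hurwitz g h p → Hurwitz (proj₁ p) (proj₂ p) (g , h)
  hurwitz-inverse (equal eq) = equal eq
  hurwitz-inverse (below lt) = subst (λ t → Hurwitz h (conj h g) (t , h)) (conj-involutive og oh lt)
    (above (subst (F._< proj₁ h) (sym (conj-proj₁ og oh lt)) lt))
  hurwitz-inverse (above gt) = subst (λ t → Hurwitz (conj g h) g (g , t)) (conj-involutive oh og gt)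
    (below (subst (F._< proj₁ g) (sym (conj-proj₁ oh og gt)) gt))

actAdj-hurwitz-ordered : ∀ l {ts : Vec (Tr n) k} → All IsTransposition ts →
                         All IsTransposition (actAdj hurwitz l ts)
actAdj-hurwitz-ordered zero    []             = []
actAdj-hurwitz-ordered zero    (o ∷ [])       = o ∷ []
actAdj-hurwitz-ordered zero    {g ∷ h ∷ _} (og ∷ oh ∷ os) =
  let a , b = hurwitz-ordered og oh (hurwitz-view g h) in a ∷ b ∷ os
actAdj-hurwitz-ordered (suc l) []             = []
actAdj-hurwitz-ordered (suc l) (o ∷ os)       = o ∷ actAdj-hurwitz-ordered l os

actAdj-hurwitz-proj₁ : ∀ l {ts : Vec (Tr n) k} → All IsTransposition ts →
                       V.map proj₁ (actAdj hurwitz l ts) ≡ actAdj swapPair l (V.map proj₁ ts)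
actAdj-hurwitz-proj₁ zero    []             = refl
actAdj-hurwitz-proj₁ zero    (o ∷ [])       = refl
actAdj-hurwitz-proj₁ zero    {g ∷ h ∷ ts} (og ∷ oh ∷ os) =
  let a , b = hurwitz-proj₁ og oh (hurwitz-view g h) in cong₂ (λ x y → x ∷ y ∷ V.map proj₁ ts) a b
actAdj-hurwitz-proj₁ (suc l) []             = refl
actAdj-hurwitz-proj₁ (suc l) (o ∷ os)       = cong (_ ∷_) (actAdj-hurwitz-proj₁ l os)

actAdj-hurwitz-product : ∀ l {ts : Vec (Tr n) k} → All IsTransposition ts →
                         (prodTr (actAdj hurwitz l ts) ⟨$⟩ʳ_) ≗ (prodTr ts ⟨$⟩ʳ_)
actAdj-hurwitz-product zero    []             x = refl
actAdj-hurwitz-product zero    (o ∷ [])       x = refl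
actAdj-hurwitz-product zero    {g ∷ h ∷ ts} (og ∷ oh ∷ os) x = hurwitz-product og oh (hurwitz-view g h) (prodTr ts ⟨$⟩ʳ x)
actAdj-hurwitz-product (suc l) []             x = refl
actAdj-hurwitz-product (suc l) {t ∷ _} (o ∷ os) x = cong (act t) (actAdj-hurwitz-product l os x)

actAdj-hurwitz-involutive : ∀ l {ts : Vec (Tr n) k} → All IsTransposition ts →
                            actAdj hurwitz l (actAdj hurwitz l ts) ≡ ts
actAdj-hurwitz-involutive zero    []             = refl
actAdj-hurwitz-involutive zero    (o ∷ [])       = refl
actAdj-hurwitz-involutive zero    {g ∷ h ∷ ts} (og ∷ oh ∷ os) =
  cong (λ p → proj₁ p ∷ proj₂ p ∷ ts)
    (hurwitz-unique (hurwitz-view _ _) (hurwitz-inverse og oh (hurwitz-view g h)))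
actAdj-hurwitz-involutive (suc l) []             = refl
actAdj-hurwitz-involutive (suc l) (o ∷ os)       = cong (_ ∷_) (actAdj-hurwitz-involutive l os)

actAdj-swap-involutive : ∀ {A : Set} l (xs : Vec A k) → actAdj swapPair l (actAdj swapPair l xs) ≡ xs
actAdj-swap-involutive zero    []           = refl
actAdj-swap-involutive zero    (x ∷ [])     = refl
actAdj-swap-involutive zero    (x ∷ y ∷ xs) = refl
actAdj-swap-involutive (suc l) []           = refl
actAdj-swap-involutive (suc l) (x ∷ xs)     = cong (x ∷_) (actAdj-swap-involutive l xs)

runWord-++ : ∀ {A : Set} (f : A → A → A × A) u w (xs : Vec A k) →
             runWord f (u L.++ w) xs ≡ runWord f w (runWord f u xs)
runWord-++ f u w xs = Lₚ.foldl-++ (λ v l → actAdj f l v) xs u w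

runWord-invariant : ∀ {A : Set} (P : Vec A k → Set) f → (∀ l {xs} → P xs → P (actAdj f l xs)) →
                    ∀ w {xs} → P xs → P (runWord f w xs)
runWord-invariant P f step []      p = p
runWord-invariant P f step (l ∷ w) p = runWord-invariant P f step w (step l p)

module _ {A : Set} (P : Vec A k → Set) (f : A → A → A × A)
         (step : ∀ l {xs} → P xs → P (actAdj f l xs))
         (inv : ∀ l {xs} → P xs → actAdj f l (actAdj f l xs) ≡ xs) where

  -- P carries the ordering i < j of the entries, under which a `hurwitz` step is an involution; for
  -- plain swaps it is trivial.
  runWord-reverse : ∀ w {xs} → P xs → runWord f (L.reverse w) (runWord f w xs) ≡ xs
  runWord-reverse []      p = refl
  runWord-reverse (l ∷ w) {xs} p = begin
    runWord f (L.reverse (l ∷ w)) ys                  ≡⟨ cong (λ v → runWord f v ys) (Lₚ.unfold-reverse l w) ⟩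
    runWord f (L.reverse w L.++ l ∷ []) ys            ≡⟨ runWord-++ f (L.reverse w) (l ∷ []) ys ⟩
    actAdj f l (runWord f (L.reverse w) ys)           ≡⟨ cong (actAdj f l) (runWord-reverse w (step l p)) ⟩
    actAdj f l (actAdj f l xs)                        ≡⟨ inv l p ⟩
    xs                                                ∎
    where
    open ≡-Reasoning
    ys = runWord f w (actAdj f l xs)

  runWord-reverse′ : ∀ w {xs} → P xs → runWord f w (runWord f (L.reverse w) xs) ≡ xs
  runWord-reverse′ w {xs} p = subst (λ v → runWord f v (runWord f (L.reverse w) xs) ≡ xs)
    (Lₚ.reverse-involutive w) (runWord-reverse (L.reverse w) p)

Ordered : Vec (Tr n) k → Set
Ordered = All IsTransposition

runWord-ordered : ∀ w {ts : Vec (Tr n) k} → Ordered ts → Ordered (runWord hurwitz w ts)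
runWord-ordered = runWord-invariant Ordered hurwitz actAdj-hurwitz-ordered

runWord-proj₁ : ∀ w {ts : Vec (Tr n) k} → Ordered ts →
                V.map proj₁ (runWord hurwitz w ts) ≡ runWord swapPair w (V.map proj₁ ts)
runWord-proj₁ []      os = refl
runWord-proj₁ (l ∷ w) os = trans (runWord-proj₁ w (actAdj-hurwitz-ordered l os))
  (cong (runWord swapPair w) (actAdj-hurwitz-proj₁ l os))

flip-cong : ∀ (π π′ : Perm n) → (π ⟨$⟩ʳ_) ≗ (π′ ⟨$⟩ʳ_) → (flip π ⟨$⟩ʳ_) ≗ (flip π′ ⟨$⟩ʳ_)
flip-cong π π′ eq x = begin
  π ⟨$⟩ˡ x                         ≡⟨ cong (π ⟨$⟩ˡ_) (inverseʳ π′) ⟨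
  π ⟨$⟩ˡ (π′ ⟨$⟩ʳ (π′ ⟨$⟩ˡ x))       ≡⟨ cong (π ⟨$⟩ˡ_) (eq _) ⟨
  π ⟨$⟩ˡ (π ⟨$⟩ʳ (π′ ⟨$⟩ˡ x))        ≡⟨ inverseˡ π ⟩
  π′ ⟨$⟩ˡ x                        ∎
  where open ≡-Reasoning

InΣ-hurwitz : ∀ l {ts : Vec (Tr n) k} → InΣ n k ts → InΣ n k (actAdj hurwitz l ts)
InΣ-hurwitz l {ts} (os , nk , le) = actAdj-hurwitz-ordered l os , trans (norm-cong same) nk ,
  trans le (sym (cong₂ _+_ (norm-cong same)
    (norm-cong λ x → flip-cong (prodTr (actAdj hurwitz l ts)) (prodTr ts) same (c x))))
  where same = actAdj-hurwitz-product l os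

-- Sorting

runWord-map-suc : ∀ {A : Set} (f : A → A → A × A) w x (xs : Vec A k) →
                  runWord f (L.map suc w) (x ∷ xs) ≡ x ∷ runWord f w xs
runWord-map-suc f []      x xs = refl
runWord-map-suc f (l ∷ w) x xs = runWord-map-suc f w x (actAdj f l xs)

countLess-actAdj : ∀ (x : Fin n) l (ys : Vec (Fin n) k) → countLess x (actAdj swapPair l ys) ≡ countLess x ys
countLess-actAdj x zero    []           = refl
countLess-actAdj x zero    (y ∷ [])     = refl
countLess-actAdj x zero    (y ∷ z ∷ ys) = begin
  b + (a + r)  ≡⟨ ℕₚ.+-assoc b a r ⟨
  b + a + r    ≡⟨ cong (_+ r) (ℕₚ.+-comm b a) ⟩
  a + b + r    ≡⟨ ℕₚ.+-assoc a b r ⟩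
  a + (b + r)  ∎
  where
  open ≡-Reasoning
  a = if toℕ y <ᵇ toℕ x then 1 else 0
  b = if toℕ z <ᵇ toℕ x then 1 else 0
  r = countLess x ys
countLess-actAdj x (suc l) []           = refl
countLess-actAdj x (suc l) (y ∷ ys)     = cong (_ +_) (countLess-actAdj x l ys)

All-actAdj : ∀ {A : Set} {P : A → Set} l {xs : Vec A k} → All P xs → All P (actAdj swapPair l xs)
All-actAdj zero    []           = []
All-actAdj zero    (p ∷ [])     = p ∷ []
All-actAdj zero    (p ∷ q ∷ ps) = q ∷ p ∷ ps
All-actAdj (suc l) []           = []
All-actAdj (suc l) (p ∷ ps)     = p ∷ All-actAdj l ps

Sorted : Vec (Fin n) k → Set
Sorted = AllPairs F._≤_

countLess-≥ : ∀ {x : Fin n} {ys : Vec (Fin n) k} → All (x F.≤_) ys → countLess x ys ≡ 0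
countLess-≥ []       = refl
countLess-≥ (p ∷ ps) rewrite <ᵇ-false p = countLess-≥ ps

-- In a sorted sequence the entries smaller than x form an initial segment, so moving x past as many
-- entries puts it in place.
insert-sorted : ∀ (x : Fin n) {ys : Vec (Fin n) k} → Sorted ys →
                Sorted (runWord swapPair (upTo (countLess x ys)) (x ∷ ys))
insert-sorted x [] = [] ∷ []
insert-sorted x {y ∷ ys} (p ∷ ss) with toℕ y ℕₚ.<? toℕ x
... | yes y<x rewrite <ᵇ-true y<x = subst Sorted (sym moved)
  (runWord-invariant (All (y F.≤_)) swapPair All-actAdj (upTo j) (ℕₚ.<⇒≤ y<x ∷ p) ∷ insert-sorted x ss)
  where
  j = countLess x ys
  -- The first letter exchanges x and y; the other letters are shifted by one and act on the tail
  -- alone.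
  moved : runWord swapPair (upTo (suc j)) (x ∷ y ∷ ys) ≡ y ∷ runWord swapPair (upTo j) (x ∷ ys)
  moved = trans (cong (λ w → runWord swapPair w (y ∷ x ∷ ys)) (sym (Lₚ.map-upTo suc j)))
    (runWord-map-suc swapPair (upTo j) y (x ∷ ys))
... | no  y≮x rewrite countLess-≥ {x = x} {y ∷ ys} (ℕₚ.≮⇒≥ y≮x ∷ All.map (ℕₚ.≤-trans (ℕₚ.≮⇒≥ y≮x)) p) =
  (ℕₚ.≮⇒≥ y≮x ∷ All.map (ℕₚ.≤-trans (ℕₚ.≮⇒≥ y≮x)) p) ∷ p ∷ ss

-- `sortWord` counts in the tail as given, whereas x is inserted into the sorted tail.
runWord-countLess : ∀ (x : Fin n) w (ys : Vec (Fin n) k) → countLess x (runWord swapPair w ys) ≡ countLess x ys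
runWord-countLess x []      ys = refl
runWord-countLess x (l ∷ w) ys = trans (runWord-countLess x w _) (countLess-actAdj x l ys)

sortWord-sorts : (xs : Vec (Fin n) k) → Sorted (runWord swapPair (sortWord xs) xs)
sortWord-sorts []       = []
sortWord-sorts (x ∷ xs) = subst Sorted (sym eq) (insert-sorted x (sortWord-sorts xs))
  where
  open ≡-Reasoning
  ys = runWord swapPair (sortWord xs) xs
  eq : runWord swapPair (sortWord (x ∷ xs)) (x ∷ xs) ≡ runWord swapPair (upTo (countLess x ys)) (x ∷ ys)
  eq = begin
    runWord swapPair (sortWord (x ∷ xs)) (x ∷ xs)
      ≡⟨ runWord-++ swapPair (L.map suc (sortWord xs)) (upTo (countLess x xs)) (x ∷ xs) ⟩
    runWord swapPair (upTo (countLess x xs)) (runWord swapPair (L.map suc (sortWord xs)) (x ∷ xs))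
      ≡⟨ cong₂ (λ j → runWord swapPair (upTo j)) (sym (runWord-countLess x (sortWord xs) xs))
           (runWord-map-suc swapPair (sortWord xs) x xs) ⟩
    runWord swapPair (upTo (countLess x ys)) (x ∷ ys) ∎

-- Γ on pairs of residue 0

Γ₀ : Vec (Fin n) k → Subset n → Vec (Tr n) k
Γ₀ A B =
  let w = sortWord A
      I = runWord swapPair w A
  in runWord hurwitz (L.reverse w) (zipWith _,_ I (Π I B))

-- The residue as an equation of sets instead of a value of `ρ`: in this form it is preserved by
-- exchanging cars and moves along with the shift.
record Residue {n k} (D : Dom n k) (x : Fin n) : Set where
  constructor residual
  field
    size      : ∣ proj₂ D ∣ ≡ suc k
    remainder : rem (proj₂ D) (proj₁ D) ≡ ⁅ x ⁆

open Residue

-- `Γ` rotates by the residue of the given sequence but parks the sorted one; this makes the two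
-- residues agree.
rem-runWord : ∀ {B : Subset n} w (A : Vec (Fin n) k) → k < ∣ B ∣ → rem B (runWord swapPair w A) ≡ rem B A
rem-runWord {B = B} w A lt = runWord-invariant (λ E → rem B E ≡ rem B A) swapPair
  (λ l {E} eq → trans (rem-actAdj l E lt) eq) w refl

sorted-map⁻ : ∀ {ts : Vec (Tr n) k} → Sorted (V.map proj₁ ts) → AllPairs (λ t u → proj₁ t F.≤ proj₁ u) ts
sorted-map⁻ {ts = []}     []       = []
sorted-map⁻ {ts = t ∷ ts} (s ∷ ss) = Allₚ.map⁻ s ∷ sorted-map⁻ ss

module _ {A : Vec (Fin (suc m)) k} {B : Subset (suc m)} (res : Residue (A , B) zero) where

  private
    w = sortWord A
    I = runWord swapPair w A
    γ₀ = zipWith _,_ I (Π I B)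

    lt : k < ∣ B ∣
    lt = ℕₚ.≤-reflexive (sym (size res))

  rem-sorted : rem B I ≡ ⁅ zero ⁆
  rem-sorted = trans (rem-runWord w A lt) (remainder res)

  private
    0∈rem : zero ∈ rem B I
    0∈rem = subst (zero ∈_) (sym rem-sorted) (Subₚ.x∈⁅x⁆ zero)

  parked-ordered : Ordered γ₀
  parked-ordered = park-ordered I 0∈rem

  Γ₀-InΣ : InΣ (suc m) k (Γ₀ A B)
  Γ₀-InΣ = runWord-invariant (InΣ (suc m) k) hurwitz InΣ-hurwitz (L.reverse w)
    (nest⇒InΣ parked-ordered (park-nest I (sortWord-sorts A) 0∈rem))

  Γ₀-proj₁ : V.map proj₁ (Γ₀ A B) ≡ A
  Γ₀-proj₁ = trans (runWord-proj₁ (L.reverse w) parked-ordered)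
    (trans (cong (runWord swapPair (L.reverse w)) (Vₚ.map-proj₁-zip I (Π I B)))
      (runWord-reverse (λ _ → ⊤) swapPair (λ _ _ → _) (λ l _ → actAdj-swap-involutive l _) w _))

  Γ₀-unsort : runWord hurwitz w (Γ₀ A B) ≡ γ₀
  Γ₀-unsort = runWord-reverse′ Ordered hurwitz actAdj-hurwitz-ordered actAdj-hurwitz-involutive w parked-ordered

-- The smaller endpoints give A, hence the sorting word. Undoing that word uncovers the parked
-- spots, which together with the residue determine B.
Γ₀-injective : ∀ {D D′ : Dom (suc m) k} → Residue D zero → Residue D′ zero →
               Γ₀ (proj₁ D) (proj₂ D) ≡ Γ₀ (proj₁ D′) (proj₂ D′) → D ≡ D′
Γ₀-injective {m} {k} {A , B} {A′ , B′} res res′ eq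
  with trans (sym (Γ₀-proj₁ {A = A} {B} res)) (trans (cong (V.map proj₁) eq) (Γ₀-proj₁ {A = A′} {B′} res′))
... | refl = cong (A ,_) (parkAll-injective I (ℕₚ.≤-reflexive (sym (size res))) (ℕₚ.≤-reflexive (sym (size res′)))
    ps (trans (rem-sorted {A = A} {B} res) (sym (rem-sorted {A = A} {B′} res′))))
  where
  I = runWord swapPair (sortWord A) A
  ps : Π I B ≡ Π I B′
  ps = trans (sym (Vₚ.map-proj₂-zip I (Π I B))) (trans (cong (V.map proj₂)
    (trans (sym (Γ₀-unsort {A = A} {B} res))
      (trans (cong (runWord hurwitz (sortWord A)) eq) (Γ₀-unsort {A = A} {B′} res′))))
    (Vₚ.map-proj₂-zip I (Π I B′)))

Γ₀-surjective : ∀ {γ : Vec (Tr (suc m)) k} → InΣ (suc m) k γ →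
                Σ (Dom (suc m) k) λ D → Residue D zero × Γ₀ (proj₁ D) (proj₂ D) ≡ γ
Γ₀-surjective {m} {k} {γ} γ∈Σ@(os , _) = (A , B) , residual (∣spots∣ os₀ nest) (trans (sym (rem-runWord w A lt))
    (trans (cong (rem B) (sym I≡)) (proj₂ parks))) , eq
  where
  A = V.map proj₁ γ
  w = sortWord A
  γ₀ = runWord hurwitz w γ
  B = spots γ₀
  os₀ : Ordered γ₀
  os₀ = runWord-ordered w os
  I≡ : V.map proj₁ γ₀ ≡ runWord swapPair w A
  I≡ = runWord-proj₁ w os
  nest : AllPairs Nest γ₀
  nest = InΣ⇒nest (sorted-map⁻ (subst Sorted (sym I≡) (sortWord-sorts A)))
    (runWord-invariant (InΣ (suc m) k) hurwitz InΣ-hurwitz w γ∈Σ)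
  lt : k < ∣ B ∣
  lt = ℕₚ.≤-reflexive (sym (∣spots∣ os₀ nest))
  parks = park-spots os₀ nest
  eq : Γ₀ A B ≡ γ
  eq = begin
    runWord hurwitz (L.reverse w) (zipWith _,_ (runWord swapPair w A) (Π (runWord swapPair w A) B))
      ≡⟨ cong (λ I → runWord hurwitz (L.reverse w) (zipWith _,_ I (Π I B))) I≡ ⟨
    runWord hurwitz (L.reverse w) (zipWith _,_ (V.map proj₁ γ₀) (Π (V.map proj₁ γ₀) B))
      ≡⟨ cong (λ J → runWord hurwitz (L.reverse w) (zipWith _,_ (V.map proj₁ γ₀) J)) (proj₁ parks) ⟩
    runWord hurwitz (L.reverse w) (zipWith _,_ (V.map proj₁ γ₀) (V.map proj₂ γ₀))
      ≡⟨ cong (runWord hurwitz (L.reverse w)) (trans (sym (Vₚ.map-<,>-zip proj₁ proj₂ γ₀)) (Vₚ.map-id γ₀)) ⟩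
    runWord hurwitz (L.reverse w) γ₀
      ≡⟨ runWord-reverse Ordered hurwitz actAdj-hurwitz-ordered actAdj-hurwitz-involutive w os ⟩
    γ ∎
    where open ≡-Reasoning

-- The shift

⁅⁆-injective : ∀ {x y : Fin n} → ⁅ x ⁆ ≡ ⁅ y ⁆ → x ≡ y
⁅⁆-injective {x = x} {y} eq = Subₚ.x∈⁅y⁆⇒x≡y y (subst (x ∈_) eq (Subₚ.x∈⁅x⁆ x))

image-⁅⁆ : ∀ (f : Fin n → Fin n) x → image f ⁅ x ⁆ ≡ ⁅ f x ⁆
image-⁅⁆ f x = Subₚ.⊆-antisym to from
  where
  to : image f ⁅ x ⁆ Sub.⊆ ⁅ f x ⁆
  to z∈ with ∈-image⁻ f z∈
  ... | y , y∈ , refl rewrite Subₚ.x∈⁅y⁆⇒x≡y x y∈ = Subₚ.x∈⁅x⁆ (f x)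
  from : ⁅ f x ⁆ Sub.⊆ image f ⁅ x ⁆
  from z∈ rewrite Subₚ.x∈⁅y⁆⇒x≡y (f x) z∈ = ∈-image⁺ f (Subₚ.x∈⁅x⁆ x)

image-id : ∀ {f : Fin n → Fin n} → (∀ x → f x ≡ x) → ∀ B → image f B ≡ B
image-id {f = f} fx≡x B = Subₚ.⊆-antisym to from
  where
  to : image f B Sub.⊆ B
  to z∈ with ∈-image⁻ f z∈
  ... | y , y∈ , refl = subst (_∈ B) (sym (fx≡x y)) y∈
  from : B Sub.⊆ image f B
  from {z} z∈ = subst (_∈ image f B) (fx≡x z) (∈-image⁺ f z∈)

image-∘ : ∀ (f g : Fin n → Fin n) B → image f (image g B) ≡ image (f ∘ g) B
image-∘ f g B = Subₚ.⊆-antisym to from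
  where
  to : image f (image g B) Sub.⊆ image (f ∘ g) B
  to z∈ with ∈-image⁻ f z∈
  ... | y , y∈ , refl with ∈-image⁻ g y∈
  ... | x , x∈ , refl = ∈-image⁺ (f ∘ g) x∈
  from : image (f ∘ g) B Sub.⊆ image f (image g B)
  from z∈ with ∈-image⁻ (f ∘ g) z∈
  ... | x , x∈ , refl = ∈-image⁺ f (∈-image⁺ g x∈)

iter-shift : ∀ s (A : Vec (Fin n) k) B → iter s shift (A , B) ≡ (V.map (c^ s) A , image (c^ s) B)
iter-shift zero    A B = cong₂ _,_ (sym (Vₚ.map-id A)) (sym (image-id (λ _ → refl) B))
iter-shift (suc s) A B = trans (cong shift (iter-shift s A B))
  (cong₂ _,_ (sym (Vₚ.map-∘ c (c^ s) A)) (image-∘ c (c^ s) B))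

iter-shift-n : (D : Dom n k) → iter n shift D ≡ D
iter-shift-n {n} (A , B) = trans (iter-shift n A B)
  (cong₂ _,_ (trans (Vₚ.map-cong c^-n A) (Vₚ.map-id A)) (image-id c^-n B))

residue-exists : (D : Dom n k) → ∣ proj₂ D ∣ ≡ suc k → ∃ (Residue D)
residue-exists {k = k} (A , B) eq with rem-nonempty A (ℕₚ.≤-reflexive (sym eq))
... | x , x∈ = x , residual eq (∣p∣≡1⇒singleton (ℕₚ.+-cancelˡ-≡ k _ _
  (trans (∣rem∣ A (ℕₚ.≤-trans (ℕₚ.n≤1+n k) (ℕₚ.≤-reflexive (sym eq)))) (trans eq (ℕₚ.+-comm 1 k)))) x∈)

residue-unique : ∀ {D : Dom n k} {x y} → Residue D x → Residue D y → x ≡ y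
residue-unique (residual _ eq) (residual _ eq′) = ⁅⁆-injective (trans (sym eq) eq′)

residue-iter : ∀ s {D : Dom n k} {x} → Residue D x → Residue (iter s shift D) (c^ s x)
residue-iter zero    res = res
residue-iter (suc s) {D} {x} res = residual (trans (∣image∣ c-injective B) (size ih))
  (trans (rem-shift A (ℕₚ.≤-reflexive (sym (size ih))))
    (trans (cong (image c) (remainder ih)) (image-⁅⁆ c (c^ s x))))
  where
  A = proj₁ (iter s shift D)
  B = proj₂ (iter s shift D)
  ih : Residue (iter s shift D) (c^ s x)
  ih = residue-iter s res

normalise : Dom n k → Fin n → Dom n k
normalise {n} D x = iter (n ∸ toℕ x) shift D

normalise-residue : ∀ {D : Dom (suc m) k} {x} → Residue D x → Residue (normalise D x) zero
normalise-residue {m} {D = D} {x} res =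
  subst (Residue (normalise D x)) (c^-zero x) (residue-iter (suc m ∸ toℕ x) res)

normalise-undo : (D : Dom n k) (x : Fin n) → iter (toℕ x) shift (normalise D x) ≡ D
normalise-undo {n} D x = trans (sym (iter-+ (toℕ x) (n ∸ toℕ x) shift D))
  (trans (cong (λ s → iter s shift D) (ℕₚ.m+[n∸m]≡n (ℕₚ.<⇒≤ (Fₚ.toℕ<n x)))) (iter-shift-n D))

Γ-normalise : ∀ {D : Dom n k} {x} → Residue D x →
              Γ (proj₁ D) (proj₂ D) ≡ Γ₀ (proj₁ (normalise D x)) (proj₂ (normalise D x))
Γ-normalise {n} {D = A , B} {x} (residual _ eq) =
  trans (cong (λ r → Γ₀ (V.map (c^ r) A) (image (c^ r) B)) rotExp≡)
    (cong (λ D → Γ₀ (proj₁ D) (proj₂ D)) (sym (iter-shift (n ∸ toℕ x) A B)))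
  where
  ρ≡ : ρ A B ≡ just x
  ρ≡ = trans (cong firstIn eq) (firstIn-singleton x)
  rotExp≡ : rotExp A B ≡ n ∸ toℕ x
  rotExp≡ with ρ A B | ρ≡
  ... | _ | refl = refl

-- For residue `zero` the exponent `rotExp` is n and not 0, so the rotation is a full turn.
Γ-normal : ∀ {D : Dom (suc m) k} → Residue D zero → Γ (proj₁ D) (proj₂ D) ≡ Γ₀ (proj₁ D) (proj₂ D)
Γ-normal {D = D} res = trans (Γ-normalise res) (cong (λ D → Γ₀ (proj₁ D) (proj₂ D)) (iter-shift-n D))

-- The shift by s moves the residue from `zero` to s mod n, so s is a multiple of n and acts
-- trivially.
normal-unique : ∀ {D D′ : Dom (suc m) k} s → Residue D zero → Residue D′ zero → iter s shift D ≡ D′ → D ≡ D′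
normal-unique {m} {D = D} s res res′ refl = sym (begin
  iter s shift D                               ≡⟨ cong (λ t → iter t shift D) s≡ ⟩
  iter (s / suc m * suc m) shift D             ≡⟨ iter-* (s / suc m) (suc m) shift D ⟩
  iter (s / suc m) (iter (suc m) shift) D      ≡⟨ iter-fixed (s / suc m) (iter-shift-n D) ⟩
  D                                            ∎)
  where
  open ≡-Reasoning
  s%≡0 : s % suc m ≡ 0
  s%≡0 = trans (cong (_% suc m) (sym (ℕₚ.+-identityʳ s)))
    (trans (sym (toℕ-c^ s zero)) (cong toℕ (residue-unique {D = iter s shift D} (residue-iter s res) res′)))
  s≡ : s ≡ s / suc m * suc m
  s≡ = trans (DM.m≡m%n+[m/n]*n s (suc m)) (cong (_+ s / suc m * suc m) s%≡0)

-- Turning by x, then s, then n - x′ leads from one normal form to the other, and two pairs of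
-- residue `zero` in one orbit coincide.
Γ-shift : ∀ {D D′ : Dom (suc m) k} {x x′} s → Residue D x → Residue D′ x′ → iter s shift D ≡ D′ →
          normalise D x ≡ normalise D′ x′
Γ-shift {m} {D = D} {x = x} {x′} s res res′ refl =
  normal-unique ((suc m ∸ toℕ x′) + (s + toℕ x)) (normalise-residue res) (normalise-residue res′) (begin
    iter (r′ + (s + toℕ x)) shift (normalise D x)              ≡⟨ iter-+ r′ (s + toℕ x) shift _ ⟩
    iter r′ shift (iter (s + toℕ x) shift (normalise D x))     ≡⟨ cong (iter r′ shift) (iter-+ s (toℕ x) shift _) ⟩
    iter r′ shift (iter s shift (iter (toℕ x) shift (normalise D x)))
      ≡⟨ cong (λ E → iter r′ shift (iter s shift E)) (normalise-undo D x) ⟩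
    iter r′ shift (iter s shift D)                             ∎)
  where
  open ≡-Reasoning
  r′ = suc m ∸ toℕ x′

-- Counting

SubsetOf : ℕ → ℕ → Set
SubsetOf n j = Σ (Subset n) λ B → ∣ B ∣ ≡ j

Σ-≡ : ∀ {A : Set} {P : A → Set} → (∀ {x} (p q : P x) → p ≡ q) → ∀ {x y : Σ A P} → proj₁ x ≡ proj₁ y → x ≡ y
Σ-≡ irr refl = cong (_ ,_) (irr _ _)

∣p∣≡0-unique : ∀ (B : Subset n) → ∣ B ∣ ≡ 0 → B ≡ Sub.⊥
∣p∣≡0-unique B eq = Subₚ.Empty-unique λ (x , x∈) → case trans (sym eq) (∣p∣≡1+∣p-x∣ x∈) of λ ()

C↔SubsetOf : ∀ n j → Fin (n C j) ↔ SubsetOf n j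
C↔SubsetOf n zero = subst (λ N → Fin N ↔ SubsetOf n 0) (sym (trans (nCk≡nC[n∸k] {k = 0} {n = n} z≤n) (nCn≡1 n)))
  (mk↔ₛ′ (λ _ → Sub.⊥ , Subₚ.∣⊥∣≡0 n) (λ _ → zero)
    (λ (B , eq) → Σ-≡ ℕₚ.≡-irrelevant (sym (∣p∣≡0-unique B eq))) (λ { zero → refl }))
C↔SubsetOf zero (suc j) = subst (λ N → Fin N ↔ SubsetOf 0 (suc j)) (sym (k>n⇒nCk≡0 {n = 0} {k = suc j} (s≤s z≤n)))
  (mk↔ₛ′ (λ ()) (λ { ([] , ()) }) (λ { ([] , ()) }) λ ())
C↔SubsetOf (suc n) (suc j) = subst (λ N → Fin N ↔ SubsetOf (suc n) (suc j)) (nCk+nC[k+1]≡[n+1]C[k+1] n j)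
  (↔-trans Fₚ.+↔⊎ (↔-trans (C↔SubsetOf n j ⊎-↔ C↔SubsetOf n (suc j)) cons))
  where
  cons : (SubsetOf n j ⊎ SubsetOf n (suc j)) ↔ SubsetOf (suc n) (suc j)
  cons = mk↔ₛ′
    (λ { (inj₁ (B , eq)) → inside ∷ B , cong suc eq ; (inj₂ (B , eq)) → outside ∷ B , eq })
    (λ { (inside ∷ B , eq) → inj₁ (B , ℕₚ.suc-injective eq) ; (outside ∷ B , eq) → inj₂ (B , eq) })
    (λ { (inside ∷ B , eq) → Σ-≡ ℕₚ.≡-irrelevant refl ; (outside ∷ B , eq) → refl })
    (λ { (inj₁ (B , eq)) → cong inj₁ (Σ-≡ ℕₚ.≡-irrelevant refl) ; (inj₂ _) → refl })

^↔Vec : ∀ n k → Fin (n ^ k) ↔ Vec (Fin n) k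
^↔Vec n zero    = mk↔ₛ′ (λ _ → []) (λ _ → zero) (λ { [] → refl }) (λ { zero → refl })
^↔Vec n (suc k) = ↔-trans Fₚ.*↔× (↔-trans (↔-refl ×-↔ ^↔Vec n k)
  (mk↔ₛ′ (λ (x , xs) → x ∷ xs) (λ { (x ∷ xs) → x , xs }) (λ { (x ∷ xs) → refl }) (λ { (x , xs) → refl })))

-- Supplies the number N without computing it; its value follows later from a comparison of
-- cardinalities.
finite-Σ : ∀ M {P : Fin M → Set} → (∀ i → Dec (P i)) → (∀ {i} (p q : P i) → p ≡ q) →
           ∃ λ N → Fin N ↔ Σ (Fin M) P
finite-Σ zero    P? irr = 0 , mk↔ₛ′ (λ ()) (λ ()) (λ ()) (λ ())
finite-Σ (suc M) {P} P? irr with finite-Σ M (P? ∘ suc) irr | P? zero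
... | N , e | yes p = suc N , mk↔ₛ′ to from to∘from from∘to
  where
  to : Fin (suc N) → Σ (Fin (suc M)) P
  to zero    = zero , p
  to (suc i) = let j , q = Inverse.to e i in suc j , q
  from : Σ (Fin (suc M)) P → Fin (suc N)
  from (zero  , _) = zero
  from (suc j , q) = suc (Inverse.from e (j , q))
  to∘from : ∀ y → to (from y) ≡ y
  to∘from (zero  , q) = cong (zero ,_) (irr p q)
  to∘from (suc j , q) = cong (λ (i , r) → suc i , r) (Inverse.strictlyInverseˡ e (j , q))
  from∘to : ∀ x → from (to x) ≡ x
  from∘to zero    = refl
  from∘to (suc i) = cong suc (Inverse.strictlyInverseʳ e i)
... | N , e | no ¬p = N , ↔-trans e skip
  where
  skip : Σ (Fin M) (P ∘ suc) ↔ Σ (Fin (suc M)) P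
  skip = mk↔ₛ′ (λ (j , q) → suc j , q)
    (λ { (zero , q) → contradiction q ¬p ; (suc j , q) → j , q })
    (λ { (zero , q) → contradiction q ¬p ; (suc j , q) → refl })
    (λ { (j , q) → refl })

-- Pairs of residue 0 as representatives of the orbits

Valid : ℕ → ℕ → Set
Valid n k = Σ (Dom n k) λ D → ∣ proj₂ D ∣ ≡ suc k

residue : Valid n k → Fin n
residue (D , eq) = proj₁ (residue-exists D eq)

residue-is : (v : Valid n k) → Residue (proj₁ v) (residue v)
residue-is (D , eq) = proj₂ (residue-exists D eq)

valid↔ : ∀ n k → Fin (n ^ k * (n C suc k)) ↔ Valid n k
valid↔ n k = ↔-trans Fₚ.*↔× (↔-trans (^↔Vec n k ×-↔ C↔SubsetOf n (suc k))
  (mk↔ₛ′ (λ (A , B , eq) → (A , B) , eq) (λ ((A , B) , eq) → A , B , eq) (λ _ → refl) (λ _ → refl)))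

-- Stated through the computed `residue`, an equation in `Fin` that can be decided when counting.
Normal : ℕ → ℕ → Set
Normal m k = Σ (Valid (suc m) k) λ v → residue v ≡ zero

valid-≡ : {v v′ : Valid n k} → proj₁ v ≡ proj₁ v′ → v ≡ v′
valid-≡ = Σ-≡ ℕₚ.≡-irrelevant

normal-≡ : {u u′ : Normal m k} → proj₁ (proj₁ u) ≡ proj₁ (proj₁ u′) → u ≡ u′
normal-≡ eq = Σ-≡ (Decidable⇒UIP.≡-irrelevant F._≟_) (valid-≡ eq)

normal : {D : Dom (suc m) k} → Residue D zero → Normal m k
normal {D = D} res = (D , size res) , residue-unique {D = D} (residue-is (D , size res)) res

normal-residue : (u : Normal m k) → Residue (proj₁ (proj₁ u)) zero
normal-residue (v , eq) = subst (Residue (proj₁ v)) eq (residue-is v)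

normal-finite : ∀ m k → ∃ λ N → Fin N ↔ Normal m k
normal-finite m k =
  let e     = valid↔ (suc m) k
      N , f = finite-Σ _ (λ i → residue (Inverse.to e i) F.≟ zero) (Decidable⇒UIP.≡-irrelevant F._≟_)
  in N , ↔-trans f (Σ-↔ e ↔-refl)

c^-toℕ-zero : (i : Fin (suc m)) → c^ (toℕ i) zero ≡ i
c^-toℕ-zero {m} i = Fₚ.toℕ-injective
  (trans (c^-below (toℕ i) zero (subst (_< suc m) (sym (ℕₚ.+-identityʳ (toℕ i))) (Fₚ.toℕ<n i)))
    (ℕₚ.+-identityʳ (toℕ i)))

rotated : ∀ {D : Dom (suc m) k} → Residue D zero → ∀ i → Residue (iter (toℕ i) shift D) i
rotated {D = D} res i = subst (Residue (iter (toℕ i) shift D)) (c^-toℕ-zero i) (residue-iter (toℕ i) res)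

-- The residue turns with the pair, so the shift acts freely: a pair amounts to its representative
-- of residue `zero` together with its own residue.
×Normal↔Valid : ∀ m k → (Fin (suc m) × Normal m k) ↔ Valid (suc m) k
×Normal↔Valid m k = mk↔ₛ′ to from to∘from from∘to
  where
  to : Fin (suc m) × Normal m k → Valid (suc m) k
  to (i , u) = iter (toℕ i) shift (proj₁ (proj₁ u)) , size (rotated (normal-residue u) i)
  from : Valid (suc m) k → Fin (suc m) × Normal m k
  from v = residue v , normal (normalise-residue (residue-is v))
  to∘from : ∀ v → to (from v) ≡ v
  to∘from v = valid-≡ (normalise-undo (proj₁ v) (residue v))
  from∘to : ∀ x → from (to x) ≡ x
  from∘to (i , u) = cong₂ _,_ (residue-unique {D = proj₁ (to (i , u))} (residue-is (to (i , u))) (rotated (normal-residue u) i))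
    (normal-≡ (sym (normal-unique (suc m ∸ toℕ x + toℕ i) (normal-residue u)
      (normalise-residue (residue-is (to (i , u)))) (iter-+ (suc m ∸ toℕ x) (toℕ i) shift _))))
    where x = residue (to (i , u))

-- Counting `Σset` thereby counts sequences and not proofs about them.
InΣ-irrelevant : ∀ {γ : Vec (Tr n) k} (p q : InΣ n k γ) → p ≡ q
InΣ-irrelevant (a , b , c) (a′ , b′ , c′) =
  cong₂ _,_ (All.irrelevant ℕₚ.≤-irrelevant a a′) (cong₂ _,_ (ℕₚ.≡-irrelevant b b′) (ℕₚ.≡-irrelevant c c′))

normal↔Σset : ∀ m k → Normal m k ↔ Σset (suc m) k
normal↔Σset m k = mk↔ₛ′ to from to∘from from∘to
  where
  to : Normal m k → Σset (suc m) k
  to u = _ , Γ₀-InΣ (normal-residue u)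
  from : Σset (suc m) k → Normal m k
  from (γ , γ∈Σ) = let _ , res , _ = Γ₀-surjective γ∈Σ in normal res
  to∘from : ∀ y → to (from y) ≡ y
  to∘from (γ , γ∈Σ) = let _ , _ , eq = Γ₀-surjective γ∈Σ in Σ-≡ InΣ-irrelevant eq
  from∘to : ∀ u → from (to u) ≡ u
  from∘to u = let D , res , eq = Γ₀-surjective (Γ₀-InΣ (normal-residue u)) in
    normal-≡ (Γ₀-injective {D = D} {proj₁ (proj₁ u)} res (normal-residue u) eq)

-- Fibres

Γ-InΣ : (D : Dom (suc m) k) → ∣ proj₂ D ∣ ≡ suc k → InΣ (suc m) k (Γ (proj₁ D) (proj₂ D))
Γ-InΣ D valid = let x , res = residue-exists D valid in
  subst (InΣ _ _) (sym (Γ-normalise res)) (Γ₀-InΣ (normalise-residue res))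

Γ-surjective : ∀ {γ : Vec (Tr (suc m)) k} → InΣ (suc m) k γ →
               Σ (Dom (suc m) k) λ D → Residue D zero × Γ (proj₁ D) (proj₂ D) ≡ γ
Γ-surjective γ∈Σ = let D , res , eq = Γ₀-surjective γ∈Σ in D , res , trans (Γ-normal res) eq

Γ-orbits : ∀ (D D′ : Dom (suc m) k) → ∣ proj₂ D ∣ ≡ suc k → ∣ proj₂ D′ ∣ ≡ suc k →
           Γ (proj₁ D) (proj₂ D) ≡ Γ (proj₁ D′) (proj₂ D′) ⇔ ∃ λ s → iter s shift D ≡ D′
Γ-orbits {m} {k} D D′ valid valid′ with residue-exists D valid | residue-exists D′ valid′
... | x , res | x′ , res′ = mk⇔ to from
  where
  to : Γ (proj₁ D) (proj₂ D) ≡ Γ (proj₁ D′) (proj₂ D′) → ∃ λ s → iter s shift D ≡ D′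
  to eq = toℕ x′ + (suc m ∸ toℕ x) , (begin
    iter (toℕ x′ + (suc m ∸ toℕ x)) shift D   ≡⟨ iter-+ (toℕ x′) (suc m ∸ toℕ x) shift D ⟩
    iter (toℕ x′) shift (normalise D x)       ≡⟨ cong (iter (toℕ x′) shift) same ⟩
    iter (toℕ x′) shift (normalise D′ x′)     ≡⟨ normalise-undo D′ x′ ⟩
    D′                                        ∎)
    where
    open ≡-Reasoning
    same : normalise D x ≡ normalise D′ x′
    same = Γ₀-injective (normalise-residue res) (normalise-residue res′)
      (trans (sym (Γ-normalise res)) (trans eq (Γ-normalise res′)))
  from : (∃ λ s → iter s shift D ≡ D′) → Γ (proj₁ D) (proj₂ D) ≡ Γ (proj₁ D′) (proj₂ D′)
  from (s , eq) = trans (Γ-normalise res)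
    (trans (cong (λ E → Γ₀ (proj₁ E) (proj₂ E)) (Γ-shift s res res′ eq)) (sym (Γ-normalise res′)))

fibre-≡ : {γ : Vec (Tr n) k} {f f′ : Fibre n k γ} → proj₁ f ≡ proj₁ f′ → f ≡ f′
fibre-≡ = Σ-≡ λ (p , q) (p′ , q′) → cong₂ _,_ (ℕₚ.≡-irrelevant p p′)
  (Decidable⇒UIP.≡-irrelevant (Vₚ.≡-dec (×ₚ.≡-dec F._≟_ F._≟_)) q q′)

normal-preimage : ∀ {D E : Dom (suc m) k} {x} → Residue D zero → Residue E x →
                  Γ (proj₁ D) (proj₂ D) ≡ Γ (proj₁ E) (proj₂ E) → iter (toℕ x) shift D ≡ E
normal-preimage {D = D} {E} {x} res resE eq = trans (cong (iter (toℕ x) shift)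
  (Γ₀-injective res (normalise-residue resE) (trans (sym (Γ-normal res)) (trans eq (Γ-normalise resE)))))
  (normalise-undo E x)

Γ-iter : ∀ {D : Dom (suc m) k} → ∣ proj₂ D ∣ ≡ suc k → ∀ s → ∣ proj₂ (iter s shift D) ∣ ≡ suc k →
         Γ (proj₁ (iter s shift D)) (proj₂ (iter s shift D)) ≡ Γ (proj₁ D) (proj₂ D)
Γ-iter {D = D} valid s valid′ = sym (Equivalence.from (Γ-orbits D (iter s shift D) valid valid′) (s , refl))

module _ {γ : Vec (Tr (suc m)) k} {D : Dom (suc m) k} (res : Residue D zero)
         (Γ≡ : Γ (proj₁ D) (proj₂ D) ≡ γ) where

  toFibre : Fin (suc m) → Fibre (suc m) k γ
  toFibre i = iter (toℕ i) shift D , size (rotated res i) ,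
    trans (Γ-iter (size res) (toℕ i) (size (rotated res i))) Γ≡

  fromFibre : Fibre (suc m) k γ → Fin (suc m)
  fromFibre f = residue (proj₁ f , proj₁ (proj₂ f))

  -- The fibre is a single orbit, and the residue indexes its elements.
  fibre↔′ : Fin (suc m) ↔ Fibre (suc m) k γ
  fibre↔′ = mk↔ₛ′ toFibre fromFibre
    (λ f → fibre-≡ {f = toFibre (fromFibre f)} {f} (normal-preimage res
      (residue-is (proj₁ f , proj₁ (proj₂ f))) (trans Γ≡ (sym (proj₂ (proj₂ f))))))
    (λ i → residue-unique {D = iter (toℕ i) shift D}
      (residue-is (iter (toℕ i) shift D , size (rotated res i))) (rotated res i))

fibre↔ : {γ : Vec (Tr (suc m)) k} → InΣ (suc m) k γ → Fin (suc m) ↔ Fibre (suc m) k γ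
fibre↔ γ∈Σ = let _ , res , Γ≡ = Γ-surjective γ∈Σ in fibre↔′ res Γ≡

-- The cardinality appears multiplied by n, which covers k = 0, where the exponent k - 1 is
-- negative. The equation compares two counts of the valid pairs: directly, and as n rotations of
-- each of the N representatives.
theorem5p4 : (n k : ℕ) → 1 ≤ n →
    ((A : Vec (Fin n) k) (B : Subset n) → ∣ B ∣ ≡ suc k → InΣ n k (Γ A B))
    × ((γ : Vec (Tr n) k) → InΣ n k γ →
    Σ (Vec (Fin n) k) (λ A → Σ (Subset n) (λ B → ∣ B ∣ ≡ suc k × Γ A B ≡ γ)))
    × ((A A′ : Vec (Fin n) k) (B B′ : Subset n) → ∣ B ∣ ≡ suc k → ∣ B′ ∣ ≡ suc k →
    (Γ A B ≡ Γ A′ B′ ⇔ ∃ (λ s → iter s shift (A , B) ≡ (A′ , B′))))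
    × ((γ : Vec (Tr n) k) → InΣ n k γ → Fin n ↔ Fibre n k γ)
    × Σ ℕ (λ N → (Fin N ↔ Σset n k) × n * N ≡ n ^ k * (n C suc k))
theorem5p4 (suc m) k _ =
    (λ A B → Γ-InΣ (A , B))
  , (λ γ γ∈Σ → let (A , B) , res , eq = Γ-surjective γ∈Σ in A , B , size res , eq)
  , (λ A A′ B B′ → Γ-orbits (A , B) (A′ , B′))
  , (λ γ → fibre↔)
  , (let N , e = normal-finite m k in N , ↔-trans e (normal↔Σset m k) ,
      ↔⇒≡ (↔-trans Fₚ.*↔× (↔-trans (↔-refl ×-↔ e) (↔-trans (×Normal↔Valid m k) (↔-sym (valid↔ (suc m) k))))))
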